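{- Let $m\ge0$ be an integer. Every $f\in LC(O,K)$ can be expanded uniquely as $$f(x)=\sum_{n=0}^\infty\beta_n^{(m)}\,\mathcal{D}_n(x)^{q^m}\qquad(x\in O),$$ with $\beta_n^{(m)}\in K$, $\beta_n^{(m)}\to0$, where the coefficients are given by $$\beta_n^{(m)}=\big((\Delta-[m]I)^nf\big)(1)=\sum_{i=0}^n\sum_{j=i}^n(-1)^{n-i}\binom{n}{j}[m]^{n-j}f(T^i)\,\mathcal{D}_i(T^j).$$
   Context: Let $q$ be a prime power, $K=\mathbf{F}_q((T))$, $O=\mathbf{F}_q[[T]]$, with $T$-adic absolute value, and $LC(O,K)$ the $K$-Banach space (sup-norm) of continuous $\mathbf{F}_q$-linear functions $O\to K$. Put $[m]=T^{q^m}-T$ (so $[0]=0$). Hasse derivatives: $\mathcal{D}_n(\sum_ia_iT^i)=\sum_i\binom{i}{n}a_iT^{i-n}$ (binomials in $\mathbf{F}_q$). The Carlitz difference operator $\Delta$ on $LC(O,K)$ is $(\Delta f)(x)=f(Tx)-Tf(x)$, and $I$ is the identity operator; binomial coefficients $\binom{n}{j}$ are read in $\mathbf{F}_q$. -}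

module Defs where

open import Level as Level using (Level; _⊔_)
open import Algebra.Bundles using (CommutativeRing; Semiring)
open import Algebra.Bundles.Raw using (RawRing)
import Algebra.Definitions.RawSemiring as RawSemiringDefinitions
open import Data.Fin.Base using (Fin; toℕ)
open import Data.Integer.Base as ℤ using (ℤ; +_; -[1+_])
open import Data.Nat.Base as ℕ using (ℕ; zero; suc; _∸_; _≥_)
open import Data.Nat.Combinatorics using (_C_)
open import Data.Nat.Primality using (Prime)
open import Data.Product.Base using (∃; ∃₂; _×_)
open import Function.Bundles using (Bijection; Func; _⟨$⟩_)
import Function.Endo.Propositional as Endo
open import Relation.Binary.Bundles using (Setoid)
open import Relation.Binary.PropositionalEquality using (_≡_)
import Relation.Binary.PropositionalEquality.Properties as ≡
open import Relation.Nullary.Negation using (¬_)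

IsPrimePower : ℕ → Set
IsPrimePower q = ∃₂ λ p e → Prime p × e ≥ 1 × q ≡ p ℕ.^ e

record FiniteField (c ℓ : Level) (q : ℕ) : Set (Level.suc (c ⊔ ℓ)) where
  field
    commutativeRing : CommutativeRing c ℓ
  open CommutativeRing commutativeRing public
  field
    0≉1         : ¬ (0# ≈ 1#)
    inverse     : ∀ x → ¬ (x ≈ 0#) → ∃ λ y → x * y ≈ 1#
    cardinality : Bijection setoid (≡.setoid (Fin q))

module LaurentSeries {c ℓ : Level} {q : ℕ} (𝔽 : FiniteField c ℓ q) where

  private
    module F where
      open FiniteField 𝔽 public
      open RawSemiringDefinitions (Semiring.rawSemiring semiring) public using (sum) renaming (_×_ to _·_)

  -- O = F_q[[T]]; x n is the coefficient of T^n.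

  O : Set c
  O = ℕ → F.Carrier

  constant : F.Carrier → O
  constant a zero    = a
  constant a (suc _) = F.0#

  O-rawRing : RawRing c ℓ
  O-rawRing = record
    { Carrier = O
    ; _≈_     = λ x y → ∀ n → x n F.≈ y n
    ; _+_     = λ x y n → x n F.+ y n
    ; _*_     = λ x y n → F.sum {suc n} λ i → x (toℕ i) F.* y (n ∸ toℕ i)
    ; -_      = λ x n → F.- x n
    ; 0#      = λ _ → F.0#
    ; 1#      = constant F.1#
    }

  module O where
    open RawRing O-rawRing public hiding (Carrier)
    open RawSemiringDefinitions (RawRing.rawSemiring O-rawRing) public using (_^_)

    T : O
    T zero          = F.0#
    T (suc zero)    = F.1#
    T (suc (suc _)) = F.0#

    infixr 8 _∙_
    _∙_ : F.Carrier → O → O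
    (a ∙ x) n = a F.* x n

    setoid : Setoid c ℓ
    setoid = record
      { Carrier       = O
      ; _≈_           = _≈_
      ; isEquivalence = record
        { refl  = λ _ → F.refl
        ; sym   = λ p n → F.sym (p n)
        ; trans = λ p r n → F.trans (p n) (r n)
        }
      }

  -- K = F_q((T)).  The pair (s , u) stands for the Laurent series T^{-s} u;
  -- different pairs may stand for the same series, and equality in K is
  -- equality of all coefficients.

  record Laurent : Set c where
    constructor T^-_∙_
    field
      pole   : ℕ
      series : O

  open Laurent public

  K : Set c
  K = Laurent

  extend : O → ℤ → F.Carrier
  extend u (+ n)    = u n
  extend u -[1+ _ ] = F.0#

  coeff : K → ℤ → F.Carrier
  coeff x i = extend (series x) (i ℤ.+ + pole x)

  K-rawRing : RawRing c ℓ
  K-rawRing = record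
    { Carrier = K
    ; _≈_     = λ x y → ∀ i → coeff x i F.≈ coeff y i
    ; _+_     = λ x y → T^- (pole x ℕ.+ pole y) ∙
                  ((O.T O.^ pole y) O.* series x O.+ (O.T O.^ pole x) O.* series y)
    ; _*_     = λ x y → T^- (pole x ℕ.+ pole y) ∙ (series x O.* series y)
    ; -_      = λ x → T^- pole x ∙ (O.- series x)
    ; 0#      = T^- 0 ∙ O.0#
    ; 1#      = T^- 0 ∙ O.1#
    }

  ι : O → K
  ι x = T^- 0 ∙ x

  module K where
    open RawRing K-rawRing public hiding (Carrier)
    open RawSemiringDefinitions (RawRing.rawSemiring K-rawRing) public using (_^_; sum)

    infixl 6 _-_
    _-_ : K → K → K
    x - y = x + (- y)

    T : K
    T = ι O.T

    infixr 8 _∙_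
    _∙_ : F.Carrier → K → K
    a ∙ (T^- s ∙ u) = T^- s ∙ (a O.∙ u)

    setoid : Setoid c ℓ
    setoid = record
      { Carrier       = K
      ; _≈_           = _≈_
      ; isEquivalence = record
        { refl  = λ _ → F.refl
        ; sym   = λ p i → F.sym (p i)
        ; trans = λ p r i → F.trans (p i) (r i)
        }
      }

    -- ∑_{i=a}^{b}; empty when b < a.
    ∑ : ℕ → ℕ → (ℕ → K) → K
    ∑ a b g = sum {suc b ∸ a} λ k → g (a ℕ.+ toℕ k)

  -- The T-adic absolute value takes only the values 0 and q^{-k} (k ∈ ℤ), so
  -- the balls |x| ≤ q^{-k} determine the topology of K and of O ⊂ K.

  infix 4 ∣_∣≤q^-_
  ∣_∣≤q^-_ : K → ℤ → Set ℓ
  ∣ x ∣≤q^- k = ∀ i → i ℤ.< k → coeff x i F.≈ F.0#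

  infix 4 _⟶_ _IsSumOf_

  _⟶_ : (ℕ → K) → K → Set ℓ
  a ⟶ x = ∀ k → ∃ λ N → ∀ n → n ≥ N → ∣ a n K.- x ∣≤q^- k

  _IsSumOf_ : K → (ℕ → K) → Set ℓ
  x IsSumOf a = (λ N → K.sum {N} λ n → a (toℕ n)) ⟶ x

  Continuous : (O → K) → Set (c ⊔ ℓ)
  Continuous f = ∀ x k → ∃ λ l → ∀ y → ∣ ι y K.- ι x ∣≤q^- l → ∣ f y K.- f x ∣≤q^- k

  record LC : Set (c ⊔ ℓ) where
    field
      func : Func O.setoid K.setoid

    ⟦_⟧ : O → K
    ⟦_⟧ = func ⟨$⟩_

    field
      additive    : ∀ x y → ⟦ x O.+ y ⟧ K.≈ ⟦ x ⟧ K.+ ⟦ y ⟧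
      homogeneous : ∀ a x → ⟦ a O.∙ x ⟧ K.≈ a K.∙ ⟦ x ⟧
      continuous  : Continuous ⟦_⟧

  open LC public using (⟦_⟧)

  [_] : ℕ → K
  [ m ] = K.T K.^ (q ℕ.^ m) K.- K.T

  binomial : ℕ → ℕ → F.Carrier
  binomial n j = (n C j) F.· F.1#

  -- The coefficient of T^k in 𝒟_n(x) comes from the term i = k + n; the terms
  -- with i < n vanish.
  𝒟 : ℕ → O → O
  𝒟 n x k = binomial (k ℕ.+ n) n F.* x (k ℕ.+ n)

  Operator : Set c
  Operator = (O → K) → (O → K)

  Δ : Operator
  Δ f x = f (O.T O.* x) K.- K.T K.* f x

  I : Operator
  I f = f

  infixl 6 _⊖_
  _⊖_ : Operator → Operator → Operator
  (A ⊖ B) f x = A f x K.- B f x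

  infixr 7 _⊛_
  _⊛_ : K → Operator → Operator
  (a ⊛ A) f x = a K.* A f x

  infixr 8 _^ᵒ_
  _^ᵒ_ : Operator → ℕ → Operator
  _^ᵒ_ = Endo._^_ (O → K)

  infix 4 _≋_
  _≋_ : (ℕ → K) → (ℕ → K) → Set ℓ
  β ≋ γ = ∀ n → β n K.≈ γ n

  IsExpansion : ℕ → LC → (ℕ → K) → Set (c ⊔ ℓ)
  IsExpansion m f β =
    (β ⟶ K.0#) × (∀ x → ⟦ f ⟧ x IsSumOf (λ n → β n K.* ι (𝒟 n x) K.^ (q ℕ.^ m)))

{-# OPTIONS --safe #-}
module Submission where

-- Put W = T^(q^m).  Then Δ - [m]I sends f to f(Tx) - W f(x), so the values
-- B n i = ((Δ - [m]I)ⁿ f)(Tⁱ) satisfy B (n+1) i = B n (i+1) - W B n i.  By the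
-- Leibniz rule 𝒟ₖ₊₁(Tx) = 𝒟ₖ(x) + T 𝒟ₖ₊₁(x) and the additivity of x ↦ x^(q^m),
-- the array 𝒟ₖ(Tʲ)^(q^m) obeys the recursion of C(j,k) W^(j-k), and the binomial
-- transform gives f(Tʲ) = ∑ₖ βₖ 𝒟ₖ(Tʲ)^(q^m) with βₖ = B k 0.  This triangular
-- system determines β.  As f(Tⁱ) → 0, the recursion for B gives
-- ord βₙ ≥ min (k , n - C) for every k, with C depending on k.  Both f and the
-- n-th partial sum are F_q-linear, so they agree on polynomials of degree < n,
-- and on the remaining part of x both are small by the bound on β and by
-- continuity.  The double sum is the inverse binomial transform, with
-- W = [m] + T expanded.

-- Binomial coefficients and the values of Hasse derivatives at powers of T enter the transforms
-- only through their recursions. The expansion and its inversion thus become two instances of one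
-- statement about such arrays, with a = W and with a = -W. The rate min (k , n - C) comes from
-- unrolling the recursion for B: each step either raises the exponent of T, towards the powers at
-- which f is small by continuity, or multiplies by W, whose order is at least 1. Low exponents
-- therefore come with high powers of W, and C absorbs the finitely many powers of T at which f is
-- only known to be bounded. A rate linear in n fits the convergence proof: if z vanishes to order
-- n, its i-th derivative keeps only order n - i, and the loss of i is made up by the order of the
-- i-th coefficient, uniformly in i.

open import Defs
open import Level using (Level; _⊔_) renaming (suc to lsuc)
open import Algebra.Bundles using (CommutativeRing)
open import Algebra.Bundles.Raw using (RawRing)
import Algebra.Properties.CommutativeMonoid.Sum as CommutativeMonoidSum
import Algebra.Properties.CommutativeSemiring.Binomial as Binomial
import Algebra.Properties.CommutativeSemiring.Exp as CommutativeSemiringExp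
import Algebra.Properties.Ring as RingProperties
import Algebra.Properties.Semiring.Exp as SemiringExp
import Algebra.Properties.Semiring.Mult as SemiringMult
import Algebra.Properties.Semiring.Sum as SemiringSum
import Algebra.Solver.Ring.NaturalCoefficients.Default as NatSolver
open import Data.Fin.Base as Fin using (Fin; toℕ; punchIn)
open import Data.Fin.Permutation using (Permutation′; permutation; _⟨$⟩ʳ_)
import Data.Fin.Properties as Fin
open import Data.Integer.Base as ℤ using (ℤ; +_; -[1+_])
import Data.Integer.Properties as ℤ
import Data.Integer.Tactic.RingSolver as ℤ-Solver
open import Data.Nat.Base as ℕ using (ℕ; zero; suc; _∸_; _≤_; _<_; s≤s; s≤s⁻¹; s<s⁻¹; z<s; s<s)
open import Data.Nat.Combinatorics using (_C_; nCn≡1; nC1≡n; k>n⇒nCk≡0; nCk+nC[k+1]≡[n+1]C[k+1])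
open import Data.Nat.Divisibility using (_∣_; divides; ∣⇒≤; m∣m*n)
open import Data.Nat.Primality using (Prime; euclidsLemma)
import Data.Nat.Properties as ℕ
import Data.Nat.Tactic.RingSolver as ℕ-Solver
open import Data.Product using (∃; ∃!; _×_; _,_; proj₁; proj₂)
open import Data.Sum.Base using (inj₁; inj₂)
open import Function.Bundles using (module Bijection; module Func)
open import Relation.Binary.Bundles using (Setoid)
open import Relation.Binary.PropositionalEquality as ≡ using (_≡_)
import Relation.Binary.Reasoning.Setoid as SetoidReasoning
open import Relation.Nullary.Decidable using (Dec; yes; no; map′)
open import Relation.Nullary.Negation using (¬_; contradiction)

-- Pascal arrays

module PascalArrays {c ℓ} (R : CommutativeRing c ℓ) where
  open CommutativeRing R
  open SemiringSum semiring
  open SemiringExp semiring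
  open RingProperties ring
  open NatSolver commutativeSemiring
  open SetoidReasoning setoid

  opaque
    -- Terms are indexed by naturals, so that the bound can vary while the terms stay the same;
    -- `Σ<-sum` and `Σ<-drop` lead back to the `Fin`-indexed sums of the statement.
    Σ< : ℕ → (ℕ → Carrier) → Carrier
    Σ< N g = sum {N} λ i → g (toℕ i)

    Σ<-cong′ : ∀ N {g h : ℕ → Carrier} → (∀ i → i < N → g i ≈ h i) → Σ< N g ≈ Σ< N h
    Σ<-cong′ N g≈h = sum-cong-≋ λ i → g≈h (toℕ i) (Fin.toℕ<n i)

    Σ<-cong : ∀ N {g h : ℕ → Carrier} → (∀ i → g i ≈ h i) → Σ< N g ≈ Σ< N h
    Σ<-cong N g≈h = Σ<-cong′ N λ i _ → g≈h i

    Σ<-zero : ∀ N {g : ℕ → Carrier} → (∀ i → i < N → g i ≈ 0#) → Σ< N g ≈ 0#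
    Σ<-zero N g≈0 = trans (Σ<-cong′ N g≈0) (sum-replicate-zero N)

    Σ<-+ : ∀ N (g h : ℕ → Carrier) → Σ< N (λ i → g i + h i) ≈ Σ< N g + Σ< N h
    Σ<-+ N g h = ∑-distrib-+ {N} _ _

    Σ<-*ˡ : ∀ N x (g : ℕ → Carrier) → x * Σ< N g ≈ Σ< N (λ i → x * g i)
    Σ<-*ˡ N x g = *-distribˡ-sum {N} x _

    Σ<-last : ∀ N (g : ℕ → Carrier) → Σ< (suc N) g ≈ Σ< N g + g N
    Σ<-last zero    g = +-comm _ _
    Σ<-last (suc N) g = begin
      g 0 + Σ< (suc N) (λ i → g (suc i))            ≈⟨ +-congˡ (Σ<-last N λ i → g (suc i)) ⟩
      g 0 + (Σ< N (λ i → g (suc i)) + g (suc N))    ≈⟨ +-assoc _ _ _ ⟨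
      Σ< (suc N) g + g (suc N)                      ∎

    Σ<-extend : ∀ {M N} (g : ℕ → Carrier) → M ≤ N → (∀ i → M ≤ i → g i ≈ 0#) → Σ< N g ≈ Σ< M g
    Σ<-extend {zero}  {N}     g _   g≈0 = Σ<-zero N λ i _ → g≈0 i ℕ.z≤n
    Σ<-extend {suc M} {suc N} g M≤N g≈0 =
      +-congˡ (Σ<-extend (λ i → g (suc i)) (s≤s⁻¹ M≤N) λ i M≤i → g≈0 (suc i) (s≤s M≤i))

    -- Meant for the inner sum of the coefficient formula, which starts at `i`: its terms below `i`
    -- vanish, so its range can be made independent of `i`, as in a product of arrays.
    Σ<-drop : ∀ i N (g : ℕ → Carrier) → (∀ j → j < i → g j ≈ 0#) →
              sum {N ∸ i} (λ k → g (i ℕ.+ toℕ k)) ≈ Σ< N g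
    Σ<-drop zero    N       g g≈0 = refl
    Σ<-drop (suc i) zero    g g≈0 = refl
    Σ<-drop (suc i) (suc N) g g≈0 = begin
      sum {N ∸ i} (λ k → g (suc i ℕ.+ toℕ k))  ≈⟨ Σ<-drop i N (λ j → g (suc j)) (λ j j<i → g≈0 (suc j) (s<s j<i)) ⟩
      Σ< N (λ j → g (suc j))                    ≈⟨ +-identityˡ _ ⟨
      0# + Σ< N (λ j → g (suc j))               ≈⟨ +-congʳ (g≈0 0 z<s) ⟨
      Σ< (suc N) g                              ∎

    Σ<-sum : ∀ N (g : ℕ → Carrier) → Σ< N g ≡ sum {N} λ i → g (toℕ i)
    Σ<-sum N g = ≡.refl

    Σ<-head : ∀ N (g : ℕ → Carrier) → Σ< (suc N) g ≡ g 0 + Σ< N (λ i → g (suc i))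
    Σ<-head N g = ≡.refl

    Σ<-one : ∀ (g : ℕ → Carrier) → Σ< 1 g ≈ g 0
    Σ<-one g = +-identityʳ _

  -- P n k = C(n,k) a^(n-k), through the recursion that characterises it.
  record IsPascal (a : Carrier) (P : ℕ → ℕ → Carrier) : Set ℓ where
    field
      origin : P 0 0 ≈ 1#
      row    : ∀ k → P 0 (suc k) ≈ 0#
      column : ∀ n → P (suc n) 0 ≈ a * P n 0
      step   : ∀ n k → P (suc n) (suc k) ≈ P n k + a * P n (suc k)

    vanish : ∀ n k → n < k → P n k ≈ 0#
    vanish zero    (suc k) _   = row k
    vanish (suc n) (suc k) n<k = begin
      P (suc n) (suc k)       ≈⟨ step n k ⟩
      P n k + a * P n (suc k) ≈⟨ +-cong (vanish n k (s<s⁻¹ n<k))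
                                        (*-congˡ (vanish n (suc k) (ℕ.m<n⇒m<1+n (s<s⁻¹ n<k)))) ⟩
      0# + a * 0#             ≈⟨ trans (+-identityˡ _) (zeroʳ a) ⟩
      0#                      ∎

    diagonal : ∀ n → P n n ≈ 1#
    diagonal zero    = origin
    diagonal (suc n) = begin
      P (suc n) (suc n)       ≈⟨ step n n ⟩
      P n n + a * P n (suc n) ≈⟨ +-cong (diagonal n) (*-congˡ (vanish n (suc n) (ℕ.n<1+n n))) ⟩
      1# + a * 0#             ≈⟨ trans (+-congˡ (zeroʳ a)) (+-identityʳ _) ⟩
      1#                      ∎

    -- Pascal's rule under the summation sign. Only the entries of row `suc n` outside column 0 have
    -- an upper left neighbour, hence one term fewer in the shifted sum.
    Σ-step : ∀ N n (g : ℕ → Carrier) →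
             Σ< (suc N) (λ k → P (suc n) k * g k) ≈
             Σ< N (λ k → P n k * g (suc k)) + a * Σ< (suc N) (λ k → P n k * g k)
    Σ-step N n g = begin
      Σ< (suc N) (λ k → P (suc n) k * g k)
        ≡⟨ Σ<-head N _ ⟩
      P (suc n) 0 * g 0 + Σ< N (λ k → P (suc n) (suc k) * g (suc k))
        ≈⟨ +-cong (trans (*-congʳ (column n)) (*-assoc _ _ _))
                  (Σ<-cong N λ k → trans (*-congʳ (step n k))
                    (solve 4 (λ a x y z → (x :+ a :* y) :* z := x :* z :+ a :* (y :* z)) refl a _ _ _)) ⟩
      a * (P n 0 * g 0) + Σ< N (λ k → P n k * g (suc k) + a * (P n (suc k) * g (suc k)))
        ≈⟨ +-congˡ (trans (Σ<-+ N _ _) (+-congˡ (sym (Σ<-*ˡ N a _)))) ⟩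
      a * (P n 0 * g 0) + (Σ< N (λ k → P n k * g (suc k)) + a * Σ< N (λ k → P n (suc k) * g (suc k)))
        ≈⟨ solve 4 (λ a x y z → a :* x :+ (y :+ a :* z) := y :+ a :* (x :+ z)) refl a _ _ _ ⟩
      Σ< N (λ k → P n k * g (suc k)) + a * (P n 0 * g 0 + Σ< N (λ k → P n (suc k) * g (suc k)))
        ≈⟨ +-congˡ (*-congˡ (reflexive (Σ<-head N _))) ⟨
      Σ< N (λ k → P n k * g (suc k)) + a * Σ< (suc N) (λ k → P n k * g k)
        ∎

    -- On sequences in `l` the recursion reads `b (suc n) = (shift + a) (b n)`, so `b n` is the n-th
    -- power of `shift + a` applied to `b 0`, and `P n k` is the coefficient of the k-th power of
    -- the shift. The bound `N` is free above `n` because in the induction it falls with `n` in one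
    -- summand and stays in the other.
    transform : (b : ℕ → ℕ → Carrier) → (∀ n l → b (suc n) l ≈ b n (suc l) + a * b n l) →
                ∀ N n l → n < N → b n l ≈ Σ< N (λ k → P n k * b 0 (l ℕ.+ k))
    transform b b-step (suc N) zero l _ = begin
      b 0 l                        ≈⟨ *-identityˡ _ ⟨
      1# * b 0 l                   ≈⟨ *-cong (sym origin) (reflexive (≡.cong (b 0) (≡.sym (ℕ.+-identityʳ l)))) ⟩
      P 0 0 * b 0 (l ℕ.+ 0)        ≈⟨ +-identityʳ _ ⟨
      P 0 0 * b 0 (l ℕ.+ 0) + 0#   ≈⟨ +-congˡ (Σ<-zero N λ k _ → trans (*-congʳ (row k)) (zeroˡ _)) ⟨
      P 0 0 * b 0 (l ℕ.+ 0) + Σ< N (λ k → P 0 (suc k) * b 0 (l ℕ.+ suc k)) ≡⟨ Σ<-head N _ ⟨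
      Σ< (suc N) (λ k → P 0 k * b 0 (l ℕ.+ k)) ∎
    transform b b-step (suc N) (suc n) l n<N = begin
      b (suc n) l
        ≈⟨ b-step n l ⟩
      b n (suc l) + a * b n l
        ≈⟨ +-cong (transform b b-step N n (suc l) (s<s⁻¹ n<N))
                  (*-congˡ (transform b b-step (suc N) n l (ℕ.m<n⇒m<1+n (s<s⁻¹ n<N)))) ⟩
      Σ< N (λ k → P n k * b 0 (suc l ℕ.+ k)) + a * Σ< (suc N) (λ k → P n k * b 0 (l ℕ.+ k))
        ≈⟨ +-congʳ (Σ<-cong N λ k → *-congˡ (reflexive (≡.cong (b 0) (≡.sym (ℕ.+-suc l k))))) ⟩
      Σ< N (λ k → P n k * b 0 (l ℕ.+ suc k)) + a * Σ< (suc N) (λ k → P n k * b 0 (l ℕ.+ k))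
        ≈⟨ Σ-step N n (λ k → b 0 (l ℕ.+ k)) ⟨
      Σ< (suc N) (λ k → P (suc n) k * b 0 (l ℕ.+ k))
        ∎

    -- The matrix is lower triangular with ones on the diagonal: once the two sequences agree below
    -- `N`, equation `N` reduces to its diagonal term.
    Σ-injective : (β γ : ℕ → Carrier) →
                  (∀ n → Σ< (suc n) (λ k → P n k * β k) ≈ Σ< (suc n) (λ k → P n k * γ k)) →
                  ∀ n → β n ≈ γ n
    Σ-injective β γ eq n = below (suc n) n (ℕ.n<1+n n)
      where
      next : ∀ N → (∀ n → n < N → β n ≈ γ n) → β N ≈ γ N
      next N IH = begin
        β N         ≈⟨ *-identityˡ _ ⟨
        1# * β N    ≈⟨ *-congʳ (diagonal N) ⟨
        P N N * β N ≈⟨ +-cancelˡ _ _ _ (begin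
          Σ< N (λ k → P N k * β k) + P N N * β N ≈⟨ Σ<-last N (λ k → P N k * β k) ⟨
          Σ< (suc N) (λ k → P N k * β k)         ≈⟨ eq N ⟩
          Σ< (suc N) (λ k → P N k * γ k)         ≈⟨ Σ<-last N (λ k → P N k * γ k) ⟩
          Σ< N (λ k → P N k * γ k) + P N N * γ N ≈⟨ +-congʳ (Σ<-cong′ N λ k k<N → *-congˡ (sym (IH k k<N))) ⟩
          Σ< N (λ k → P N k * β k) + P N N * γ N ∎) ⟩
        P N N * γ N ≈⟨ *-congʳ (diagonal N) ⟩
        1# * γ N    ≈⟨ *-identityˡ _ ⟩
        γ N         ∎

      below : ∀ N n → n < N → β n ≈ γ n
      below (suc N) n n<1+N = next n λ k k<n → below N k (ℕ.<-≤-trans k<n (s≤s⁻¹ n<1+N))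

  open IsPascal

  -- Composing the binomial transforms for a and b gives the one for a + b.
  product-isPascal : ∀ {a b P Q} → IsPascal a P → IsPascal b Q →
                     IsPascal (a + b) λ n k → Σ< (suc n) λ j → P n j * Q j k
  product-isPascal {a} {b} {P} {Q} isP isQ = record
    { origin = trans (Σ<-one _) (trans (*-cong (origin isP) (origin isQ)) (*-identityˡ _))
    ; row    = λ k → trans (Σ<-one _) (trans (*-congˡ (row isQ k)) (zeroʳ _))
    ; column = λ n → begin
        Σ< (suc (suc n)) (λ j → P (suc n) j * Q j 0)
          ≈⟨ expand n 0 ⟩
        Σ< (suc n) (λ j → P n j * Q (suc j) 0) + a * PQ n 0
          ≈⟨ +-congʳ (trans (Σ<-cong (suc n) λ j → trans (*-congˡ (column isQ j))
                              (solve 3 (λ x b y → x :* (b :* y) := b :* (x :* y)) refl _ _ _))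
                            (sym (Σ<-*ˡ (suc n) b _))) ⟩
        b * PQ n 0 + a * PQ n 0
          ≈⟨ trans (+-comm _ _) (sym (distribʳ _ _ _)) ⟩
        (a + b) * PQ n 0
          ∎
    ; step   = λ n k → begin
        Σ< (suc (suc n)) (λ j → P (suc n) j * Q j (suc k))
          ≈⟨ expand n (suc k) ⟩
        Σ< (suc n) (λ j → P n j * Q (suc j) (suc k)) + a * PQ n (suc k)
          ≈⟨ +-congʳ (trans (Σ<-cong (suc n) λ j → trans (*-congˡ (step isQ j k))
                              (solve 4 (λ x y b z → x :* (y :+ b :* z) := x :* y :+ b :* (x :* z)) refl _ _ _ _))
                            (trans (Σ<-+ (suc n) _ _) (+-congˡ (sym (Σ<-*ˡ (suc n) b _))))) ⟩
        PQ n k + b * PQ n (suc k) + a * PQ n (suc k)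
          ≈⟨ solve 4 (λ x b y a → x :+ b :* y :+ a :* y := x :+ (a :+ b) :* y) refl _ _ _ _ ⟩
        PQ n k + (a + b) * PQ n (suc k)
          ∎
    }
    where
    PQ : ℕ → ℕ → Carrier
    PQ n k = Σ< (suc n) λ j → P n j * Q j k

    expand : ∀ n k → Σ< (suc (suc n)) (λ j → P (suc n) j * Q j k) ≈
                     Σ< (suc n) (λ j → P n j * Q (suc j) k) + a * PQ n k
    expand n k = begin
      Σ< (suc (suc n)) (λ j → P (suc n) j * Q j k)
        ≈⟨ Σ-step isP (suc n) n (λ j → Q j k) ⟩
      Σ< (suc n) (λ j → P n j * Q (suc j) k) + a * Σ< (suc (suc n)) (λ j → P n j * Q j k)
        ≈⟨ +-congˡ (*-congˡ (Σ<-extend _ (ℕ.n≤1+n (suc n))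
             λ j n<j → trans (*-congʳ (vanish isP n j n<j)) (zeroˡ _))) ⟩
      Σ< (suc n) (λ j → P n j * Q (suc j) k) + a * PQ n k
        ∎

  -- Scaling the entries by the powers c^(n-k) replaces a by c a; here c = -1. This yields the array
  -- of shift - W, which inverts the one of shift + W.
  signed-isPascal : ∀ {a P} → IsPascal a P → IsPascal (- a) λ n k → (- 1#) ^ (n ∸ k) * P n k
  signed-isPascal {a} {P} isP = record
    { origin = trans (*-identityˡ _) (origin isP)
    ; row    = λ k → trans (*-congˡ (row isP k)) (zeroʳ _)
    ; column = λ n → trans (*-congˡ (column isP n)) (flip n (P n 0))
    ; step   = step′
    }
    where
    flip : ∀ n x → (- 1# * (- 1#) ^ n) * (a * x) ≈ - a * ((- 1#) ^ n * x)
    flip n x = begin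
      (- 1# * (- 1#) ^ n) * (a * x) ≈⟨ solve 4 (λ u v a x → (u :* v) :* (a :* x) := (u :* a) :* (v :* x)) refl _ _ _ _ ⟩
      (- 1# * a) * ((- 1#) ^ n * x) ≈⟨ *-congʳ (-1*x≈-x a) ⟩
      - a * ((- 1#) ^ n * x)        ∎

    step′ : ∀ n k → (- 1#) ^ (n ∸ k) * P (suc n) (suc k) ≈
                    (- 1#) ^ (n ∸ k) * P n k + - a * ((- 1#) ^ (n ∸ suc k) * P n (suc k))
    step′ n k with n ℕ.≤? k
    -- Both truncated differences are 0 here, so the sign fails to alternate; the entry that carries
    -- it is above the diagonal and vanishes.
    ... | yes n≤k = begin
      (- 1#) ^ (n ∸ k) * P (suc n) (suc k)
        ≈⟨ *-congˡ (step isP n k) ⟩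
      (- 1#) ^ (n ∸ k) * (P n k + a * P n (suc k))
        ≈⟨ *-congˡ (trans (+-congˡ (trans (*-congˡ Pnk≈0) (zeroʳ _))) (+-identityʳ _)) ⟩
      (- 1#) ^ (n ∸ k) * P n k
        ≈⟨ trans (+-congˡ (trans (*-congˡ (trans (*-congˡ Pnk≈0) (zeroʳ _))) (zeroʳ _))) (+-identityʳ _) ⟨
      (- 1#) ^ (n ∸ k) * P n k + - a * ((- 1#) ^ (n ∸ suc k) * P n (suc k))
        ∎
      where Pnk≈0 = vanish isP n (suc k) (s≤s n≤k)
    ... | no n≰k = begin
      (- 1#) ^ (n ∸ k) * P (suc n) (suc k)
        ≈⟨ *-congˡ (step isP n k) ⟩
      (- 1#) ^ (n ∸ k) * (P n k + a * P n (suc k))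
        ≈⟨ distribˡ _ _ _ ⟩
      (- 1#) ^ (n ∸ k) * P n k + (- 1#) ^ (n ∸ k) * (a * P n (suc k))
        ≈⟨ +-congˡ (*-congʳ (^-congʳ (- 1#) (ℕ.+-∸-assoc 1 (ℕ.≰⇒> n≰k)))) ⟩
      (- 1#) ^ (n ∸ k) * P n k + (- 1# * (- 1#) ^ (n ∸ suc k)) * (a * P n (suc k))
        ≈⟨ +-congˡ (flip (n ∸ suc k) _) ⟩
      (- 1#) ^ (n ∸ k) * P n k + - a * ((- 1#) ^ (n ∸ suc k) * P n (suc k))
        ∎

-- Finite fields

nC0≡1 : ∀ n → n C 0 ≡ 1
nC0≡1 zero    = ≡.refl
nC0≡1 (suc n) = ≡.refl

absorption : ∀ n k → suc k ℕ.* (suc n C suc k) ≡ suc n ℕ.* (n C k)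
absorption zero    zero    = ≡.refl
absorption zero    (suc k) = ℕ.*-zeroʳ k
absorption (suc n) zero    = begin
  1 ℕ.* (2+n C 1)        ≡⟨ ℕ.*-identityˡ _ ⟩
  2+n C 1                ≡⟨ nC1≡n 2+n ⟩
  2+n                    ≡⟨ ℕ.*-identityʳ 2+n ⟨
  2+n ℕ.* 1              ∎
  where
  open ≡.≡-Reasoning
  2+n = suc (suc n)
absorption (suc n) (suc k) = begin
  suc (suc k) ℕ.* (suc (suc n) C suc (suc k))
    ≡⟨ ≡.cong (suc (suc k) ℕ.*_) (nCk+nC[k+1]≡[n+1]C[k+1] (suc n) (suc k)) ⟨
  suc (suc k) ℕ.* (x ℕ.+ (suc n C suc (suc k)))
    ≡⟨ distribute k x (suc n C suc (suc k)) ⟩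
  x ℕ.+ (suc k ℕ.* x ℕ.+ suc (suc k) ℕ.* (suc n C suc (suc k)))
    ≡⟨ ≡.cong (x ℕ.+_) (≡.cong₂ ℕ._+_ (absorption n k) (absorption n (suc k))) ⟩
  x ℕ.+ (suc n ℕ.* (n C k) ℕ.+ suc n ℕ.* (n C suc k))
    ≡⟨ ≡.cong (x ℕ.+_) (ℕ.*-distribˡ-+ (suc n) (n C k) (n C suc k)) ⟨
  x ℕ.+ suc n ℕ.* ((n C k) ℕ.+ (n C suc k))
    ≡⟨ ≡.cong (λ y → x ℕ.+ suc n ℕ.* y) (nCk+nC[k+1]≡[n+1]C[k+1] n k) ⟩
  suc (suc n) ℕ.* x
    ∎
  where
  open ≡.≡-Reasoning
  x = suc n C suc k

  distribute : ∀ k x y → suc (suc k) ℕ.* (x ℕ.+ y) ≡ x ℕ.+ (suc k ℕ.* x ℕ.+ suc (suc k) ℕ.* y)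
  distribute = ℕ-Solver.solve-∀

-- By `absorption`, p divides (k + 1) C(p , k + 1), and k + 1 is positive and too small to be a
-- multiple of p.
prime∣C : ∀ {p} → Prime p → ∀ k → suc k < p → p ∣ p C suc k
prime∣C {suc p} pp k k<p
  with euclidsLemma (suc k) (suc p C suc k) pp
         (≡.subst (suc p ∣_) (≡.sym (absorption p k)) (m∣m*n (p C k)))
... | inj₁ p∣k = contradiction (∣⇒≤ p∣k) (ℕ.<⇒≱ k<p)
... | inj₂ p∣C = p∣C

module Frobenius {c ℓ} (R : CommutativeRing c ℓ) {p : ℕ} (pp : Prime p) where
  open CommutativeRing R
  open SemiringMult semiring using (×-assoc-*; ×-congˡ; ×-assocˡ; ×-congʳ) renaming (_×_ to _·_)
  open SemiringExp semiring using (_^_; ^-assocʳ; ^-congˡ)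
  open PascalArrays R
  open SetoidReasoning setoid

  module _ (p≈0 : p · 1# ≈ 0#) where

    p∣n⇒n·x≈0 : ∀ {n} x → p ∣ n → n · x ≈ 0#
    p∣n⇒n·x≈0 x (divides d ≡.refl) = begin
      (d ℕ.* p) · x     ≈⟨ ×-congˡ (ℕ.*-comm d p) ⟩
      (p ℕ.* d) · x     ≈⟨ ×-assocˡ x p d ⟨
      p · (d · x)       ≈⟨ ×-congʳ p (*-identityˡ _) ⟨
      p · (1# * d · x)  ≈⟨ ×-assoc-* p _ _ ⟨
      (p · 1#) * d · x  ≈⟨ trans (*-congʳ p≈0) (zeroˡ _) ⟩
      0#                ∎

    frobenius : ∀ x y → (x + y) ^ p ≈ x ^ p + y ^ p
    frobenius x y = expand p ≡.refl
      where
      -- The exponent is abstracted so that it can be matched as a successor, which lets both outer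
      -- terms of the binomial expansion be split off.
      expand : ∀ r → r ≡ p → (x + y) ^ r ≈ x ^ r + y ^ r
      expand zero    ≡.refl = contradiction pp λ ()
      expand (suc r) ≡.refl = begin
        (x + y) ^ suc r
          ≈⟨ Binomial.theorem commutativeSemiring (suc r) x y ⟩
        Binomial.binomialExpansion commutativeSemiring x y (suc r)
          ≡⟨ Σ<-sum (suc (suc r)) term ⟨
        Σ< (suc (suc r)) term
          ≈⟨ Σ<-last (suc r) term ⟩
        Σ< (suc r) term + term (suc r)
          ≡⟨ ≡.cong (_+ term (suc r)) (Σ<-head r term) ⟩
        term 0 + Σ< r (λ k → term (suc k)) + term (suc r)
          ≈⟨ +-congʳ (+-congˡ (Σ<-zero r λ k k<r → p∣n⇒n·x≈0 _ (prime∣C pp k (s<s k<r)))) ⟩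
        term 0 + 0# + term (suc r)
          ≈⟨ +-cong (trans (+-identityʳ _) (trans (+-identityʳ _) (*-identityˡ _))) top ⟩
        y ^ suc r + x ^ suc r
          ≈⟨ +-comm _ _ ⟩
        x ^ suc r + y ^ suc r
          ∎
        where
        term : ℕ → Carrier
        term k = (suc r C k) · (x ^ k * y ^ (suc r ∸ k))

        top : term (suc r) ≈ x ^ suc r
        top = begin
          (suc r C suc r) · (x ^ suc r * y ^ (r ∸ r)) ≡⟨ ≡.cong₂ (λ n k → n · (x ^ suc r * y ^ k)) (nCn≡1 (suc r)) (ℕ.n∸n≡0 r) ⟩
          1 · (x ^ suc r * 1#)                        ≈⟨ trans (+-identityʳ _) (*-identityʳ _) ⟩
          x ^ suc r                                   ∎

    frobenius^ : ∀ k x y → (x + y) ^ (p ℕ.^ k) ≈ x ^ (p ℕ.^ k) + y ^ (p ℕ.^ k)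
    frobenius^ zero    x y = distribʳ _ _ _
    frobenius^ (suc k) x y = begin
      (x + y) ^ (p ℕ.* p ℕ.^ k)                          ≈⟨ ^-assocʳ _ p _ ⟨
      ((x + y) ^ p) ^ (p ℕ.^ k)                          ≈⟨ ^-congˡ (p ℕ.^ k) (frobenius x y) ⟩
      (x ^ p + y ^ p) ^ (p ℕ.^ k)                        ≈⟨ frobenius^ k _ _ ⟩
      (x ^ p) ^ (p ℕ.^ k) + (y ^ p) ^ (p ℕ.^ k)          ≈⟨ +-cong (^-assocʳ x p _) (^-assocʳ y p _) ⟩
      x ^ (p ℕ.* p ℕ.^ k) + y ^ (p ℕ.* p ℕ.^ k)          ∎

module FiniteFieldProperties {c ℓ q} (𝔽 : FiniteField c ℓ q) where
  open FiniteField 𝔽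
  open Bijection cardinality using (to; to⁻; injective; surjective) renaming (cong to to-cong)
  open RingProperties ring using (+-cancelˡ)
  open SemiringMult semiring using (×1-homo-*; ×-congˡ) renaming (_×_ to _·_)
  open SemiringExp semiring using (_^_; ^-congˡ; ^-assocʳ)
  open SetoidReasoning setoid
  private
    module ∑ = CommutativeMonoidSum +-commutativeMonoid
    module ∏ = CommutativeMonoidSum *-commutativeMonoid

  infix 4 _≟_
  _≟_ : ∀ x y → Dec (x ≈ y)
  x ≟ y = map′ injective to-cong (to x Fin.≟ to y)

  to∘to⁻ : ∀ i → to (to⁻ i) ≡ i
  to∘to⁻ i = proj₂ (surjective i) refl

  to⁻∘to : ∀ x → to⁻ (to x) ≈ x
  to⁻∘to x = injective (to∘to⁻ (to x))

  -- Carries a bijection of the field over to its enumeration by `Fin q`, so that sums and products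
  -- over the whole field can be reindexed.
  permute : (g h : Carrier → Carrier) →
            (∀ {x y} → x ≈ y → g x ≈ g y) → (∀ {x y} → x ≈ y → h x ≈ h y) →
            (∀ x → g (h x) ≈ x) → (∀ x → h (g x) ≈ x) → Permutation′ q
  permute g h g-cong h-cong gh hg = permutation
    (λ i → to (g (to⁻ i))) (λ i → to (h (to⁻ i)))
    (λ i → ≡.trans (to-cong (trans (g-cong (to⁻∘to _)) (gh _))) (to∘to⁻ i))
    (λ i → ≡.trans (to-cong (trans (h-cong (to⁻∘to _)) (hg _))) (to∘to⁻ i))

  -- Translation by 1 permutes the elements, so their sum S satisfies S = S + q · 1.
  q·1≈0 : q · 1# ≈ 0#
  q·1≈0 = +-cancelˡ (∑.sum to⁻) _ _ (begin
    ∑.sum to⁻ + q · 1#                ≈⟨ +-congˡ (∑.sum-replicate q) ⟨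
    ∑.sum to⁻ + ∑.sum {q} (λ _ → 1#)  ≈⟨ ∑.∑-distrib-+ {q} to⁻ (λ _ → 1#) ⟨
    ∑.sum {q} (λ i → to⁻ i + 1#)      ≈⟨ ∑.sum-cong-≋ (λ i → to⁻∘to (to⁻ i + 1#)) ⟨
    ∑.sum {q} (λ i → to⁻ (π ⟨$⟩ʳ i))  ≈⟨ ∑.sum-permute to⁻ π ⟨
    ∑.sum to⁻                         ≈⟨ +-identityʳ _ ⟨
    ∑.sum to⁻ + 0#                    ∎)
    where
    π : Permutation′ q
    π = permute (_+ 1#) (_- 1#) +-congʳ +-congʳ
      (λ x → trans (+-assoc _ _ _) (trans (+-congˡ (-‿inverseˡ _)) (+-identityʳ _)))
      (λ x → trans (+-assoc _ _ _) (trans (+-congˡ (-‿inverseʳ _)) (+-identityʳ _)))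

  x≉0⇒xy≈0⇒y≈0 : ∀ {x y} → ¬ x ≈ 0# → x * y ≈ 0# → y ≈ 0#
  x≉0⇒xy≈0⇒y≈0 {x} {y} x≉0 xy≈0 with inverse x x≉0
  ... | x⁻¹ , xx⁻¹≈1 = begin
    y              ≈⟨ *-identityˡ y ⟨
    1# * y         ≈⟨ *-congʳ (trans (*-comm _ _) xx⁻¹≈1) ⟨
    (x⁻¹ * x) * y  ≈⟨ *-assoc _ _ _ ⟩
    x⁻¹ * (x * y)  ≈⟨ trans (*-congˡ xy≈0) (zeroʳ _) ⟩
    0#             ∎

  -- By `q·1≈0` the e-th power of `p · 1#` is zero. A field has no zero divisors, so factors can be
  -- cancelled until one of them is zero; running out of factors would give 1 = 0.
  characteristic : ∀ p e → q ≡ p ℕ.^ e → p · 1# ≈ 0#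
  characteristic p e q≡p^e = root e (trans (×-congˡ (≡.sym q≡p^e)) q·1≈0)
    where
    root : ∀ e → (p ℕ.^ e) · 1# ≈ 0# → p · 1# ≈ 0#
    root zero    1≈0 = contradiction (sym (trans (sym (+-identityʳ _)) 1≈0)) 0≉1
    root (suc e) pᵉ≈0 with p · 1# ≟ 0#
    ... | yes p≈0 = p≈0
    ... | no  p≉0 = root e (x≉0⇒xy≈0⇒y≈0 p≉0 (trans (sym (×1-homo-* p (p ℕ.^ e))) pᵉ≈0))

  -- With 0 replaced by 1, the product of the nonzero elements can be taken over all of `Fin q`,
  -- without enumerating the nonzero elements separately.
  unit : Carrier → Carrier
  unit x with x ≟ 0#
  ... | yes _ = 1#
  ... | no  _ = x

  unit-cong : ∀ {x y} → x ≈ y → unit x ≈ unit y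
  unit-cong {x} {y} x≈y with x ≟ 0# | y ≟ 0#
  ... | yes _   | yes _   = refl
  ... | no  _   | no  _   = x≈y
  ... | yes x≈0 | no  y≉0 = contradiction (trans (sym x≈y) x≈0) y≉0
  ... | no  x≉0 | yes y≈0 = contradiction (trans x≈y y≈0) x≉0

  unit-invertible : ∀ x → ∃ λ y → unit x * y ≈ 1#
  unit-invertible x with x ≟ 0#
  ... | yes _   = 1# , *-identityˡ 1#
  ... | no  x≉0 = inverse x x≉0

  ∏unit-invertible : ∀ {n} (xs : Fin n → Carrier) → ∃ λ y → ∏.sum (λ i → unit (xs i)) * y ≈ 1#
  ∏unit-invertible {zero}  xs = 1# , *-identityˡ 1#
  ∏unit-invertible {suc n} xs
    with unit-invertible (xs Fin.zero) | ∏unit-invertible (λ i → xs (Fin.suc i))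
  ... | y , xy≈1 | z , xz≈1 = y * z ,
    trans (solve 4 (λ a b y z → (a :* b) :* (y :* z) := (a :* y) :* (b :* z)) refl _ _ _ _)
          (trans (*-cong xy≈1 xz≈1) (*-identityˡ _))
    where open NatSolver commutativeSemiring

  -- For a ≠ 0 this is the quotient of `unit (a * x)` by `unit x`; its product over the field is
  -- a^(q-1).
  factor : Carrier → Carrier → Carrier
  factor a x with x ≟ 0#
  ... | yes _ = 1#
  ... | no  _ = a

  factor-0 : ∀ a {x} → x ≈ 0# → factor a x ≈ 1#
  factor-0 a {x} x≈0 with x ≟ 0#
  ... | yes _   = refl
  ... | no  x≉0 = contradiction x≈0 x≉0

  factor-≉0 : ∀ a {x} → ¬ x ≈ 0# → factor a x ≈ a
  factor-≉0 a {x} x≉0 with x ≟ 0#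
  ... | yes x≈0 = contradiction x≈0 x≉0
  ... | no  _   = refl

  unit-* : ∀ {a} → ¬ a ≈ 0# → ∀ x → unit (a * x) ≈ factor a x * unit x
  unit-* {a} a≉0 x with x ≟ 0# | a * x ≟ 0#
  ... | yes _   | yes _    = sym (*-identityˡ _)
  ... | no  _   | no  _    = refl
  ... | yes x≈0 | no  ax≉0 = contradiction (trans (*-congˡ x≈0) (zeroʳ _)) ax≉0
  ... | no  x≉0 | yes ax≈0 = contradiction (x≉0⇒xy≈0⇒y≈0 a≉0 ax≈0) x≉0

  -- Multiplication by a ≠ 0 permutes the elements and replaces the product of
  -- the nonzero ones by itself times a^(q-1).
  ∏factor≈1 : ∀ {a} → ¬ a ≈ 0# → ∏.sum (λ i → factor a (to⁻ i)) ≈ 1#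
  ∏factor≈1 {a} a≉0 with inverse a a≉0 | ∏unit-invertible to⁻
  ... | a⁻¹ , aa⁻¹≈1 | y , Py≈1 = begin
    H            ≈⟨ *-identityʳ _ ⟨
    H * 1#       ≈⟨ *-congˡ Py≈1 ⟨
    H * (P * y)  ≈⟨ *-assoc _ _ _ ⟨
    (H * P) * y  ≈⟨ *-congʳ HP≈P ⟩
    P * y        ≈⟨ Py≈1 ⟩
    1#           ∎
    where
    P H : Carrier
    P = ∏.sum λ i → unit (to⁻ i)
    H = ∏.sum λ i → factor a (to⁻ i)

    π : Permutation′ q
    π = permute (a *_) (a⁻¹ *_) *-congˡ *-congˡ
      (λ x → trans (sym (*-assoc _ _ _)) (trans (*-congʳ aa⁻¹≈1) (*-identityˡ _)))
      (λ x → trans (sym (*-assoc _ _ _)) (trans (*-congʳ (trans (*-comm _ _) aa⁻¹≈1)) (*-identityˡ _)))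

    HP≈P : H * P ≈ P
    HP≈P = begin
      H * P                                            ≈⟨ ∏.∑-distrib-+ {q} _ _ ⟨
      ∏.sum (λ i → factor a (to⁻ i) * unit (to⁻ i))    ≈⟨ ∏.sum-cong-≋ (λ i → unit-* a≉0 (to⁻ i)) ⟨
      ∏.sum (λ i → unit (a * to⁻ i))                   ≈⟨ ∏.sum-cong-≋ (λ i → unit-cong (to⁻∘to (a * to⁻ i))) ⟨
      ∏.sum (λ i → unit (to⁻ (π ⟨$⟩ʳ i)))              ≈⟨ ∏.sum-permute (λ i → unit (to⁻ i)) π ⟨
      P                                                ∎

  nonEmpty : ∃ λ r → q ≡ suc r
  nonEmpty = positive (to 0#)
    where
    positive : ∀ {n} → Fin n → ∃ λ r → n ≡ suc r
    positive {suc r} _ = r , ≡.refl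

  a^q≈a : ∀ a → a ^ q ≈ a
  a^q≈a a with nonEmpty | a ≟ 0#
  ... | r , q≡1+r | yes a≈0 = begin
    a ^ q           ≡⟨ ≡.cong (a ^_) q≡1+r ⟩
    a * a ^ r       ≈⟨ trans (*-congʳ a≈0) (zeroˡ _) ⟩
    0#              ≈⟨ a≈0 ⟨
    a               ∎
  ... | r , q≡1+r | no  a≉0 = begin
    a ^ q           ≡⟨ ≡.cong (a ^_) q≡1+r ⟩
    a * a ^ r       ≈⟨ *-congˡ (split q≡1+r to⁻ (to 0#) (to⁻∘to 0#) λ i i≢ x≈0 → i≢ (≡.trans (≡.sym (to∘to⁻ i)) (to-cong x≈0))) ⟨
    a * ∏.sum (λ i → factor a (to⁻ i)) ≈⟨ *-congˡ (∏factor≈1 a≉0) ⟩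
    a * 1#          ≈⟨ *-identityʳ a ⟩
    a               ∎
    where
    -- Exactly one index, that of zero, contributes 1, and the other r = q - 1 contribute a. The
    -- enumeration is abstracted so that its size can be matched with `suc r`.
    split : ∀ {n} → n ≡ suc r → (from : Fin n → Carrier) (i₀ : Fin n) →
            from i₀ ≈ 0# → (∀ i → ¬ i ≡ i₀ → ¬ from i ≈ 0#) →
            ∏.sum (λ i → factor a (from i)) ≈ a ^ r
    split ≡.refl from i₀ from-i₀≈0 from≉0 = begin
      ∏.sum (λ i → factor a (from i))
        ≈⟨ ∏.sum-remove {i = i₀} (λ i → factor a (from i)) ⟩
      factor a (from i₀) * ∏.sum (λ j → factor a (from (punchIn i₀ j)))
        ≈⟨ *-cong (factor-0 a from-i₀≈0)
                  (∏.sum-cong-≋ λ j → factor-≉0 a (from≉0 _ (Fin.punchInᵢ≢i i₀ j))) ⟩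
      1# * ∏.sum {r} (λ _ → a)
        ≈⟨ trans (*-identityˡ _) (∏.sum-replicate r) ⟩
      a ^ r
        ∎

  a^q^m≈a : ∀ m a → a ^ (q ℕ.^ m) ≈ a
  a^q^m≈a zero    a = *-identityʳ a
  a^q^m≈a (suc m) a = begin
    a ^ (q ℕ.* q ℕ.^ m)  ≈⟨ ^-assocʳ a q (q ℕ.^ m) ⟨
    (a ^ q) ^ (q ℕ.^ m)  ≈⟨ ^-congˡ (q ℕ.^ m) (a^q≈a a) ⟩
    a ^ (q ℕ.^ m)        ≈⟨ a^q^m≈a m a ⟩
    a                    ∎

-- Power series

module PowersAndMultiples {c ℓ} (R : CommutativeRing c ℓ) where
  open CommutativeRing R public
  open CommutativeSemiringExp commutativeSemiring public
  open SemiringMult semiring public using () renaming (_×_ to _·_)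
  open RingProperties ring public

module PowerSeries {c ℓ q} (𝔽 : FiniteField c ℓ q) where
  open LaurentSeries 𝔽
  open FiniteField 𝔽
  open NatSolver commutativeSemiring
  open SetoidReasoning setoid
  open SemiringSum semiring using (sum-cong-≋; sum-replicate-zero)
  open SemiringMult semiring using (×-homo-+; ×-congˡ) renaming (_×_ to _·_)
  open SemiringExp semiring using (_^_)
  open FiniteFieldProperties 𝔽 using (characteristic; a^q^m≈a; nonEmpty)

  tail : O → O
  tail x n = x (suc n)

  -- Multiplication unfolds to (x * y)₀ = x₀ y₀ + 0 and (x * y)ₙ₊₁ = x₀ yₙ₊₁ + (tail x * y)ₙ,
  -- whence the ring laws by induction on the coefficient.
  *ᴼ-cong : ∀ {x x′ y y′} → x O.≈ x′ → y O.≈ y′ → x O.* y O.≈ x′ O.* y′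
  *ᴼ-cong x≈x′ y≈y′ n = sum-cong-≋ {suc n} λ i → *-cong (x≈x′ (toℕ i)) (y≈y′ (n ∸ toℕ i))

  *ᴼ-distribʳ : ∀ z x y → (x O.+ y) O.* z O.≈ x O.* z O.+ y O.* z
  *ᴼ-distribʳ z x y zero    = solve 3 (λ x y z → (x :+ y) :* z :+ con 0 := x :* z :+ con 0 :+ (y :* z :+ con 0)) refl _ _ _
  *ᴼ-distribʳ z x y (suc n) = trans (+-congˡ (*ᴼ-distribʳ z (tail x) (tail y) n))
    (solve 5 (λ x y z a b → (x :+ y) :* z :+ (a :+ b) := x :* z :+ a :+ (y :* z :+ b)) refl _ _ _ _ _)

  ∙-*ᴼ-assoc : ∀ a x y → (a O.∙ x) O.* y O.≈ a O.∙ (x O.* y)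
  ∙-*ᴼ-assoc a x y zero    = solve 3 (λ a x y → a :* x :* y :+ con 0 := a :* (x :* y :+ con 0)) refl _ _ _
  ∙-*ᴼ-assoc a x y (suc n) = trans (+-congˡ (∙-*ᴼ-assoc a (tail x) y n))
    (solve 4 (λ a x y z → a :* x :* y :+ a :* z := a :* (x :* y :+ z)) refl _ _ _ _)

  *ᴼ-assoc : ∀ x y z → (x O.* y) O.* z O.≈ x O.* (y O.* z)
  *ᴼ-assoc x y z zero    = solve 3 (λ x y z → (x :* y :+ con 0) :* z :+ con 0 := x :* (y :* z :+ con 0) :+ con 0) refl _ _ _
  *ᴼ-assoc x y z (suc n) = begin
    (x 0 * y 0 + 0#) * z (suc n) + ((x 0 O.∙ tail y O.+ tail x O.* y) O.* z) n
      ≈⟨ +-congˡ (*ᴼ-distribʳ z (x 0 O.∙ tail y) (tail x O.* y) n) ⟩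
    (x 0 * y 0 + 0#) * z (suc n) + (((x 0 O.∙ tail y) O.* z) n + ((tail x O.* y) O.* z) n)
      ≈⟨ +-congˡ (+-cong (∙-*ᴼ-assoc (x 0) (tail y) z n) (*ᴼ-assoc (tail x) y z n)) ⟩
    (x 0 * y 0 + 0#) * z (suc n) + (x 0 * (tail y O.* z) n + (tail x O.* (y O.* z)) n)
      ≈⟨ solve 5 (λ x y z a b → (x :* y :+ con 0) :* z :+ (x :* a :+ b) := x :* (y :* z :+ a) :+ b) refl _ _ _ _ _ ⟩
    x 0 * (y 0 * z (suc n) + (tail y O.* z) n) + (tail x O.* (y O.* z)) n
      ∎

  -- The recursion to which multiplication unfolds peels a coefficient off the left factor; this
  -- mirror image peels one off the right, which is what commutativity requires.
  *ᴼ-sucʳ : ∀ x y n → (x O.* y) (suc n) ≈ x (suc n) * y 0 + (x O.* tail y) n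
  *ᴼ-sucʳ x y zero    = solve 4 (λ x y x′ y′ → x :* y′ :+ (x′ :* y :+ con 0) := x′ :* y :+ (x :* y′ :+ con 0)) refl _ _ _ _
  *ᴼ-sucʳ x y (suc n) = trans (+-congˡ (*ᴼ-sucʳ (tail x) y n))
    (solve 5 (λ x y x′ y′ z → x :* y′ :+ (x′ :* y :+ z) := x′ :* y :+ (x :* y′ :+ z)) refl _ _ _ _ _)

  *ᴼ-comm : ∀ x y → x O.* y O.≈ y O.* x
  *ᴼ-comm x y zero    = +-congʳ (*-comm _ _)
  *ᴼ-comm x y (suc n) = trans (+-cong (*-comm _ _) (*ᴼ-comm (tail x) y n)) (sym (*ᴼ-sucʳ y x n))

  *ᴼ-zeroˡ : ∀ x → O.0# O.* x O.≈ O.0#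
  *ᴼ-zeroˡ x n = trans (sum-cong-≋ {suc n} λ i → zeroˡ (x (n ∸ toℕ i))) (sum-replicate-zero (suc n))

  constant-*ᴼ : ∀ a x → constant a O.* x O.≈ a O.∙ x
  constant-*ᴼ a x zero    = +-identityʳ _
  constant-*ᴼ a x (suc n) = trans (+-congˡ (*ᴼ-zeroˡ x n)) (+-identityʳ _)

  *ᴼ-identityˡ : ∀ x → O.1# O.* x O.≈ x
  *ᴼ-identityˡ x n = trans (constant-*ᴼ 1# x n) (*-identityˡ _)

  O-commutativeRing : CommutativeRing c ℓ
  O-commutativeRing = record
    { RawRing′
    ; isCommutativeRing = record
      { isRing = record
        { +-isAbelianGroup = record
          { isGroup = record
            { isMonoid = record
              { isSemigroup = record
                { isMagma = record
                  { isEquivalence = Setoid.isEquivalence O.setoid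
                  ; ∙-cong        = λ p r n → +-cong (p n) (r n)
                  }
                ; assoc = λ _ _ _ _ → +-assoc _ _ _
                }
              ; identity = (λ _ _ → +-identityˡ _) , (λ _ _ → +-identityʳ _)
              }
            ; inverse = (λ _ _ → -‿inverseˡ _) , (λ _ _ → -‿inverseʳ _)
            ; ⁻¹-cong = λ p n → -‿cong (p n)
            }
          ; comm = λ _ _ _ → +-comm _ _
          }
        ; *-cong     = *ᴼ-cong
        ; *-assoc    = *ᴼ-assoc
        ; *-identity = *ᴼ-identityˡ , λ x n → trans (*ᴼ-comm x O.1# n) (*ᴼ-identityˡ x n)
        ; distrib    = (λ x y z n → trans (*ᴼ-comm x (y O.+ z) n) (trans (*ᴼ-distribʳ x y z n)
                         (+-cong (*ᴼ-comm y x n) (*ᴼ-comm z x n))))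
                     , *ᴼ-distribʳ
        }
      ; *-comm = *ᴼ-comm
      }
    }
    where module RawRing′ = RawRing O-rawRing

  private module ᴼ = PowersAndMultiples O-commutativeRing

  T-*ᴼ-zero : ∀ x → (O.T O.* x) 0 ≈ 0#
  T-*ᴼ-zero x = trans (+-identityʳ _) (zeroˡ _)

  T-*ᴼ-suc : ∀ x n → (O.T O.* x) (suc n) ≈ x n
  T-*ᴼ-suc x n = begin
    0# * x (suc n) + (tail O.T O.* x) n  ≈⟨ +-cong (zeroˡ _) (*ᴼ-cong tailT≈1 (ᴼ.refl {x}) n) ⟩
    0# + (O.1# O.* x) n                  ≈⟨ trans (+-identityˡ _) (*ᴼ-identityˡ x n) ⟩
    x n                                  ∎
    where
    tailT≈1 : tail O.T O.≈ O.1#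
    tailT≈1 zero    = refl
    tailT≈1 (suc n) = refl

  T^-*ᴼ-+ : ∀ s x n → (O.T O.^ s O.* x) (s ℕ.+ n) ≈ x n
  T^-*ᴼ-+ zero    x n = *ᴼ-identityˡ x n
  T^-*ᴼ-+ (suc s) x n = trans (*ᴼ-assoc O.T (O.T O.^ s) x (suc s ℕ.+ n))
    (trans (T-*ᴼ-suc (O.T O.^ s O.* x) (s ℕ.+ n)) (T^-*ᴼ-+ s x n))

  T^-*ᴼ-< : ∀ s x n → n < s → (O.T O.^ s O.* x) n ≈ 0#
  T^-*ᴼ-< (suc s) x zero    _   = trans (*ᴼ-assoc O.T (O.T O.^ s) x 0) (T-*ᴼ-zero (O.T O.^ s O.* x))
  T^-*ᴼ-< (suc s) x (suc n) n<s = trans (*ᴼ-assoc O.T (O.T O.^ s) x (suc n))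
    (trans (T-*ᴼ-suc (O.T O.^ s O.* x) n) (T^-*ᴼ-< s x n (s<s⁻¹ n<s)))

  T^-≡ : ∀ s → (O.T O.^ s) s ≈ 1#
  T^-≡ zero    = refl
  T^-≡ (suc s) = trans (T-*ᴼ-suc (O.T O.^ s) s) (T^-≡ s)

  T^-≢ : ∀ s n → ¬ n ≡ s → (O.T O.^ s) n ≈ 0#
  T^-≢ zero    zero    n≢s = contradiction ≡.refl n≢s
  T^-≢ zero    (suc n) _   = refl
  T^-≢ (suc s) zero    _   = T-*ᴼ-zero (O.T O.^ s)
  T^-≢ (suc s) (suc n) n≢s = trans (T-*ᴼ-suc (O.T O.^ s) n) (T^-≢ s n λ n≡s → n≢s (≡.cong suc n≡s))

  -- Assembled from monomials by sums and scalar multiples, not by cases on the index, so that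
  -- F_q-linear maps can be evaluated on it by induction on the degree.
  truncate : ℕ → O → O
  truncate zero    x = O.0#
  truncate (suc L) x = truncate L x O.+ x L O.∙ O.T O.^ L

  truncate-≥ : ∀ L x n → L ≤ n → truncate L x n ≈ 0#
  truncate-≥ zero    x n _   = refl
  truncate-≥ (suc L) x n L<n = begin
    truncate L x n + x L * (O.T O.^ L) n  ≈⟨ +-cong (truncate-≥ L x n (ℕ.<⇒≤ L<n)) (*-congˡ (T^-≢ L n (ℕ.>⇒≢ L<n))) ⟩
    0# + x L * 0#                         ≈⟨ trans (+-identityˡ _) (zeroʳ _) ⟩
    0#                                    ∎

  truncate-< : ∀ L x n → n < L → truncate L x n ≈ x n
  truncate-< (suc L) x n n<1+L with n ℕ.≟ L
  ... | yes ≡.refl = begin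
    truncate n x n + x n * (O.T O.^ n) n  ≈⟨ +-cong (truncate-≥ n x n ℕ.≤-refl) (*-congˡ (T^-≡ n)) ⟩
    0# + x n * 1#                         ≈⟨ trans (+-identityˡ _) (*-identityʳ _) ⟩
    x n                                   ∎
  ... | no n≢L = begin
    truncate L x n + x L * (O.T O.^ L) n  ≈⟨ +-cong (truncate-< L x n (ℕ.≤∧≢⇒< (s≤s⁻¹ n<1+L) n≢L)) (*-congˡ (T^-≢ L n n≢L)) ⟩
    x n + x L * 0#                        ≈⟨ trans (+-congˡ (zeroʳ _)) (+-identityʳ _) ⟩
    x n                                   ∎

  Vanishes : ℕ → O → Set ℓ
  Vanishes a x = ∀ n → n < a → x n ≈ 0#

  Vanishes-*ᴼ : ∀ {b} x {y} → Vanishes b y → Vanishes b (x O.* y)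
  Vanishes-*ᴼ x {y} vy n n<b = trans
    (sum-cong-≋ {suc n} λ i → trans (*-congˡ (vy (n ∸ toℕ i) (ℕ.≤-<-trans (ℕ.m∸n≤m n (toℕ i)) n<b))) (zeroʳ (x (toℕ i))))
    (sum-replicate-zero (suc n))

  -- A single factor already vanishes to order `b`. The exponent is a successor because the zeroth
  -- power is 1, which has order 0.
  Vanishes-^ : ∀ {b x} N → Vanishes b x → Vanishes b (x O.^ suc N)
  Vanishes-^ {b} {x} N vx n n<b = trans (*ᴼ-comm x (x O.^ N) n) (Vanishes-*ᴼ (x O.^ N) vx n n<b)

  constant-^ : ∀ a n → constant a O.^ n O.≈ constant (a ^ n)
  constant-^ a zero    k = refl
  constant-^ a (suc n) k = trans (constant-*ᴼ a (constant a O.^ n) k)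
    (trans (*-congˡ (constant-^ a n k)) (∙-constant k))
    where
    ∙-constant : ∀ k → a * constant (a ^ n) k ≈ constant (a * a ^ n) k
    ∙-constant zero    = refl
    ∙-constant (suc k) = zeroʳ a

  ·-coefficient : ∀ n x k → (n ᴼ.· x) k ≈ n · x k
  ·-coefficient zero    x k = refl
  ·-coefficient (suc n) x k = +-congˡ (·-coefficient n x k)

  p·1ᴼ≈0 : ∀ {p} → p · 1# ≈ 0# → p ᴼ.· O.1# O.≈ O.0#
  p·1ᴼ≈0 {p} p≈0 zero    = trans (·-coefficient p O.1# 0) p≈0
  p·1ᴼ≈0 {p} p≈0 (suc k) = trans (·-coefficient p O.1# (suc k)) (n·0≈0 p)
    where
    n·0≈0 : ∀ n → n · 0# ≈ 0#
    n·0≈0 zero    = refl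
    n·0≈0 (suc n) = trans (+-identityˡ _) (n·0≈0 n)

  -- Since q^m = p^(e m), this is the Frobenius map of a ring of characteristic p, iterated e m
  -- times.
  ^q^m-+ : IsPrimePower q → ∀ m x y → (x O.+ y) O.^ (q ℕ.^ m) O.≈ x O.^ (q ℕ.^ m) O.+ y O.^ (q ℕ.^ m)
  ^q^m-+ (p , e , pp , _ , q≡p^e) m x y = ≡.subst
    (λ N → (x O.+ y) O.^ N O.≈ x O.^ N O.+ y O.^ N)
    (≡.trans (≡.sym (ℕ.^-*-assoc p e m)) (≡.cong (ℕ._^ m) (≡.sym q≡p^e)))
    (Frobenius.frobenius^ O-commutativeRing pp (p·1ᴼ≈0 {p} (characteristic p e q≡p^e)) (e ℕ.* m) x y)

  -- The scalar comes out unchanged because elements of F_q are fixed by a ↦ a^(q^m). With `^q^m-+`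
  -- this makes x ↦ x^(q^m) linear over F_q.
  ^q^m-∙ : ∀ m a x → (a O.∙ x) O.^ (q ℕ.^ m) O.≈ a O.∙ x O.^ (q ℕ.^ m)
  ^q^m-∙ m a x n = begin
    ((a O.∙ x) O.^ N) n               ≈⟨ ᴼ.^-congˡ N (constant-*ᴼ a x) n ⟨
    ((constant a O.* x) O.^ N) n      ≈⟨ ᴼ.^-distrib-* (constant a) x N n ⟩
    (constant a O.^ N O.* x O.^ N) n  ≈⟨ ᴼ.*-congʳ {x O.^ N} (constant-^ a N) n ⟩
    (constant (a ^ N) O.* x O.^ N) n  ≈⟨ constant-*ᴼ (a ^ N) (x O.^ N) n ⟩
    a ^ N * (x O.^ N) n               ≈⟨ *-congʳ (a^q^m≈a m a) ⟩
    a * (x O.^ N) n                   ∎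
    where N = q ℕ.^ m

  q^m≡suc : ∀ m → ∃ λ N → q ℕ.^ m ≡ suc N
  q^m≡suc m = suc-pred (q ℕ.^ m) (ℕ.m^n>0 q {{ℕ.>-nonZero (≡.subst (0 <_) (≡.sym (proj₂ nonEmpty)) z<s)}} m)
    where
    suc-pred : ∀ n → 0 < n → ∃ λ N → n ≡ suc N
    suc-pred (suc n) _ = n , ≡.refl

  binomial-pascal : ∀ n k → binomial (suc n) (suc k) ≈ binomial n k + binomial n (suc k)
  binomial-pascal n k = trans (×-congˡ (≡.sym (nCk+nC[k+1]≡[n+1]C[k+1] n k))) (×-homo-+ 1# (n C k) (n C suc k))

  binomial-zero : ∀ n → binomial n 0 ≈ 1#
  binomial-zero n = trans (×-congˡ (nC0≡1 n)) (+-identityʳ _)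

  binomial-< : ∀ {n k} → n < k → binomial n k ≈ 0#
  binomial-< n<k = ×-congˡ (k>n⇒nCk≡0 n<k)

  𝒟-+ : ∀ n x y → 𝒟 n (x O.+ y) O.≈ 𝒟 n x O.+ 𝒟 n y
  𝒟-+ n x y k = distribˡ _ _ _

  𝒟-∙ : ∀ n a x → 𝒟 n (a O.∙ x) O.≈ a O.∙ 𝒟 n x
  𝒟-∙ n a x k = solve 3 (λ b a x → b :* (a :* x) := a :* (b :* x)) refl _ _ _

  𝒟-cong : ∀ n {x y} → x O.≈ y → 𝒟 n x O.≈ 𝒟 n y
  𝒟-cong n x≈y k = *-congˡ (x≈y (k ℕ.+ n))

  𝒟₀ : ∀ x → 𝒟 0 x O.≈ x
  𝒟₀ x k = begin
    binomial (k ℕ.+ 0) 0 * x (k ℕ.+ 0)  ≈⟨ *-congʳ (binomial-zero (k ℕ.+ 0)) ⟩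
    1# * x (k ℕ.+ 0)                    ≈⟨ *-identityˡ _ ⟩
    x (k ℕ.+ 0)                         ≡⟨ ≡.cong x (ℕ.+-identityʳ k) ⟩
    x k                                 ∎

  𝒟-1 : ∀ n → 𝒟 (suc n) O.1# O.≈ O.0#
  𝒟-1 n k rewrite ℕ.+-suc k n = zeroʳ _

  -- Coefficient by coefficient this is Pascal's rule; in the constant coefficient the last term
  -- drops out on both sides, as C(n , n + 1) = 0.
  𝒟-T : ∀ n x → 𝒟 (suc n) (O.T O.* x) O.≈ 𝒟 n x O.+ O.T O.* 𝒟 (suc n) x
  𝒟-T n x k = begin
    binomial (k ℕ.+ suc n) (suc n) * (O.T O.* x) (k ℕ.+ suc n)
      ≡⟨ ≡.cong (λ i → binomial i (suc n) * (O.T O.* x) i) (ℕ.+-suc k n) ⟩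
    binomial (suc (k ℕ.+ n)) (suc n) * (O.T O.* x) (suc (k ℕ.+ n))
      ≈⟨ *-cong (binomial-pascal (k ℕ.+ n) n) (T-*ᴼ-suc x (k ℕ.+ n)) ⟩
    (binomial (k ℕ.+ n) n + binomial (k ℕ.+ n) (suc n)) * x (k ℕ.+ n)
      ≈⟨ distribʳ _ _ _ ⟩
    𝒟 n x k + binomial (k ℕ.+ n) (suc n) * x (k ℕ.+ n)
      ≈⟨ +-congˡ (second k) ⟩
    𝒟 n x k + (O.T O.* 𝒟 (suc n) x) k
      ∎
    where
    second : ∀ k → binomial (k ℕ.+ n) (suc n) * x (k ℕ.+ n) ≈ (O.T O.* 𝒟 (suc n) x) k
    second zero    = trans (trans (*-congʳ (binomial-< (ℕ.n<1+n n))) (zeroˡ _)) (sym (T-*ᴼ-zero (𝒟 (suc n) x)))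
    second (suc k) = sym (trans (T-*ᴼ-suc (𝒟 (suc n) x) k)
      (reflexive (≡.cong (λ i → binomial i (suc n) * x i) (ℕ.+-suc k n))))

  𝒟-Vanishes : ∀ {L x} n → n ≤ L → Vanishes L x → Vanishes (L ∸ n) (𝒟 n x)
  𝒟-Vanishes n n≤L vx k k<L∸n = trans (*-congˡ (vx (k ℕ.+ n) (ℕ.m≤o∸n⇒m+n≤o (suc k) n≤L k<L∸n))) (zeroʳ _)

-- Laurent series

module FractionIdentities {c ℓ} (R : CommutativeRing c ℓ) where
  open CommutativeRing R
  open NatSolver commutativeSemiring

  *-interchange : ∀ a b x y → (a * b) * (x * y) ≈ (a * x) * (b * y)
  *-interchange = solve 4 (λ a b x y → (a :* b) :* (x :* y) := (a :* x) :* (b :* y)) refl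

  -- The identity (x/a + y/b)(z/c) = xz/(ac) + yz/(bc), with each side brought to one fraction and
  -- then cross-multiplied; a, b, c stand for powers of T.
  fraction-distribʳ : ∀ a b c x y z →
    ((a * c) * (b * c)) * ((b * x + a * y) * z) ≈ ((a * b) * c) * ((b * c) * (x * z) + (a * c) * (y * z))
  fraction-distribʳ = solve 6 (λ a b c x y z →
    ((a :* c) :* (b :* c)) :* ((b :* x :+ a :* y) :* z) :=
    ((a :* b) :* c) :* ((b :* c) :* (x :* z) :+ (a :* c) :* (y :* z))) refl

module LaurentRing {c ℓ q} (𝔽 : FiniteField c ℓ q) where
  open LaurentSeries 𝔽
  open PowerSeries 𝔽
  open FiniteField 𝔽
  open RingProperties ring using (-0#≈0#)
  open SetoidReasoning setoid
  private module ᴼ where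
    open PowersAndMultiples O-commutativeRing public
    open FractionIdentities O-commutativeRing public

  extend-cong : ∀ {u v} → u O.≈ v → ∀ i → extend u i ≈ extend v i
  extend-cong u≈v (+ n)    = u≈v n
  extend-cong u≈v -[1+ n ] = refl

  extend-+ : ∀ u v i → extend (u O.+ v) i ≈ extend u i + extend v i
  extend-+ u v (+ n)    = refl
  extend-+ u v -[1+ n ] = sym (+-identityˡ _)

  extend-neg : ∀ u i → extend (O.- u) i ≈ - extend u i
  extend-neg u (+ n)    = refl
  extend-neg u -[1+ n ] = sym -0#≈0#

  extend-Vanishes : ∀ s u i → Vanishes s u → i ℤ.< + s → extend u i ≈ 0#
  extend-Vanishes s u (+ n)    vu (ℤ.+<+ n<s) = vu n n<s
  extend-Vanishes s u -[1+ n ] vu _           = refl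

  extend-shift : ∀ s u i → extend (O.T O.^ s O.* u) (i ℤ.+ + s) ≈ extend u i
  extend-shift s u (+ n) = trans (reflexive (≡.cong (O.T O.^ s O.* u) (ℕ.+-comm n s))) (T^-*ᴼ-+ s u n)
  extend-shift s u -[1+ n ] = extend-Vanishes s _ (-[1+ n ] ℤ.+ + s) (T^-*ᴼ-< s u)
    (ℤ.<-≤-trans (ℤ.+-monoˡ-< (+ s) (ℤ.-<+ {n} {0})) (ℤ.≤-reflexive (ℤ.+-identityˡ (+ s))))

  coeff-shift : ∀ x s i → extend (O.T O.^ s O.* series x) (i ℤ.+ + (pole x ℕ.+ s)) ≈ coeff x i
  coeff-shift x s i = begin
    extend u (i ℤ.+ + (pole x ℕ.+ s))    ≡⟨ ≡.cong (extend u) (ℤ.+-assoc i (+ pole x) (+ s)) ⟨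
    extend u (i ℤ.+ + pole x ℤ.+ + s)    ≈⟨ extend-shift s (series x) (i ℤ.+ + pole x) ⟩
    coeff x i                            ∎
    where u = O.T O.^ s O.* series x

  coeff-shift′ : ∀ x s i → extend (O.T O.^ s O.* series x) (i ℤ.+ + (s ℕ.+ pole x)) ≈ coeff x i
  coeff-shift′ x s i = trans (reflexive (≡.cong (λ t → extend (O.T O.^ s O.* series x) (i ℤ.+ + t)) (ℕ.+-comm s (pole x)))) (coeff-shift x s i)

  infix 4 _~_
  -- Equality of fractions by cross-multiplication. Sums in `K` are easy to compare by coefficients,
  -- products are not; for them this form reduces the ring laws to identities in `O`.
  _~_ : K → K → Set ℓ
  x ~ y = O.T O.^ pole y O.* series x O.≈ O.T O.^ pole x O.* series y

  ~⇒≈ : ∀ x y → x ~ y → x K.≈ y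
  ~⇒≈ x y x~y i = begin
    coeff x i                                                        ≈⟨ coeff-shift x (pole y) i ⟨
    extend (O.T O.^ pole y O.* series x) (i ℤ.+ + (pole x ℕ.+ pole y))  ≈⟨ extend-cong x~y (i ℤ.+ + (pole x ℕ.+ pole y)) ⟩
    extend (O.T O.^ pole x O.* series y) (i ℤ.+ + (pole x ℕ.+ pole y))  ≈⟨ coeff-shift′ y (pole x) i ⟩
    coeff y i                                                        ∎

  ≈⇒~ : ∀ x y → x K.≈ y → x ~ y
  ≈⇒~ x y x≈y n = begin
    u n                ≡⟨ ≡.cong (extend u) i+s≡n ⟨
    extend u (i ℤ.+ s) ≈⟨ coeff-shift x (pole y) i ⟩
    coeff x i          ≈⟨ x≈y i ⟩
    coeff y i          ≈⟨ coeff-shift′ y (pole x) i ⟨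
    extend v (i ℤ.+ s) ≡⟨ ≡.cong (extend v) i+s≡n ⟩
    v n                ∎
    where
    u v : O
    u = O.T O.^ pole y O.* series x
    v = O.T O.^ pole x O.* series y
    s i : ℤ
    s = + (pole x ℕ.+ pole y)
    -- Both numerators are taken over the common denominator T^s, so their coefficient `n` is the
    -- coefficient n - s of the Laurent series.
    i = + n ℤ.- s
    i+s≡n : i ℤ.+ s ≡ + n
    i+s≡n = ≡.trans (ℤ.+-assoc (+ n) (ℤ.- s) s) (≡.trans (≡.cong (λ z → + n ℤ.+ z) (ℤ.+-inverseˡ s)) (ℤ.+-identityʳ (+ n)))

  T^-cong : ∀ {s t u v} → s ≡ t → u O.≈ v → T^- s ∙ u K.≈ T^- t ∙ v
  T^-cong {s} ≡.refl u≈v i = extend-cong u≈v (i ℤ.+ + s)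

  coeff-+ : ∀ x y i → coeff (x K.+ y) i ≈ coeff x i + coeff y i
  coeff-+ x y i = trans (extend-+ _ _ (i ℤ.+ + (pole x ℕ.+ pole y)))
    (+-cong (coeff-shift x (pole y) i) (coeff-shift′ y (pole x) i))

  coeff-neg : ∀ x i → coeff (K.- x) i ≈ - coeff x i
  coeff-neg x i = extend-neg (series x) (i ℤ.+ + pole x)

  coeff-0 : ∀ i → coeff K.0# i ≈ 0#
  coeff-0 i = extend-0 (i ℤ.+ + 0)
    where
    extend-0 : ∀ i → extend O.0# i ≈ 0#
    extend-0 (+ n)    = refl
    extend-0 -[1+ n ] = refl

  *ᴷ-cong : ∀ {x x′ y y′} → x K.≈ x′ → y K.≈ y′ → x K.* y K.≈ x′ K.* y′
  *ᴷ-cong {x} {x′} {y} {y′} x≈x′ y≈y′ = ~⇒≈ (x K.* y) (x′ K.* y′) λ n → begin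
    (T^ (pole x′ ℕ.+ pole y′) O.* (series x O.* series y)) n
      ≈⟨ ᴼ.*-congʳ {series x O.* series y} (ᴼ.^-homo-* O.T (pole x′) (pole y′)) n ⟩
    ((T^ (pole x′) O.* T^ (pole y′)) O.* (series x O.* series y)) n
      ≈⟨ ᴼ.*-interchange (T^ (pole x′)) (T^ (pole y′)) (series x) (series y) n ⟩
    ((T^ (pole x′) O.* series x) O.* (T^ (pole y′) O.* series y)) n
      ≈⟨ *ᴼ-cong (≈⇒~ x x′ x≈x′) (≈⇒~ y y′ y≈y′) n ⟩
    ((T^ (pole x) O.* series x′) O.* (T^ (pole y) O.* series y′)) n
      ≈⟨ ᴼ.*-interchange (T^ (pole x)) (T^ (pole y)) (series x′) (series y′) n ⟨
    ((T^ (pole x) O.* T^ (pole y)) O.* (series x′ O.* series y′)) n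
      ≈⟨ ᴼ.*-congʳ {series x′ O.* series y′} (ᴼ.^-homo-* O.T (pole x) (pole y)) n ⟨
    (T^ (pole x ℕ.+ pole y) O.* (series x′ O.* series y′)) n
      ∎
    where
    T^ : ℕ → O
    T^ = O.T O.^_

  *ᴷ-comm : ∀ x y → x K.* y K.≈ y K.* x
  *ᴷ-comm x y = T^-cong (ℕ.+-comm (pole x) (pole y)) (*ᴼ-comm (series x) (series y))

  *ᴷ-identityˡ : ∀ x → K.1# K.* x K.≈ x
  *ᴷ-identityˡ x = T^-cong ≡.refl (*ᴼ-identityˡ (series x))

  *ᴷ-distribʳ : ∀ z x y → (x K.+ y) K.* z K.≈ x K.* z K.+ y K.* z
  *ᴷ-distribʳ z x y = ~⇒≈ ((x K.+ y) K.* z) (x K.* z K.+ y K.* z) λ n → begin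
    (T^ ((a ℕ.+ c′) ℕ.+ (b ℕ.+ c′)) O.* ((T^ b O.* u O.+ T^ a O.* v) O.* w)) n
      ≈⟨ ᴼ.*-congʳ {(T^ b O.* u O.+ T^ a O.* v) O.* w} (ᴼ.trans (hom (a ℕ.+ c′) (b ℕ.+ c′)) (ᴼ.*-cong (hom a c′) (hom b c′))) n ⟩
    (((T^ a O.* T^ c′) O.* (T^ b O.* T^ c′)) O.* ((T^ b O.* u O.+ T^ a O.* v) O.* w)) n
      ≈⟨ ᴼ.fraction-distribʳ (T^ a) (T^ b) (T^ c′) u v w n ⟩
    (((T^ a O.* T^ b) O.* T^ c′) O.* ((T^ b O.* T^ c′) O.* (u O.* w) O.+ (T^ a O.* T^ c′) O.* (v O.* w))) n
      ≈⟨ ᴼ.*-cong (ᴼ.trans (hom (a ℕ.+ b) c′) (ᴼ.*-congʳ {T^ c′} (hom a b)))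
           (ᴼ.+-cong (ᴼ.*-congʳ {u O.* w} (hom b c′)) (ᴼ.*-congʳ {v O.* w} (hom a c′))) n ⟨
    (T^ ((a ℕ.+ b) ℕ.+ c′) O.* (T^ (b ℕ.+ c′) O.* (u O.* w) O.+ T^ (a ℕ.+ c′) O.* (v O.* w))) n
      ∎
    where
    T^ : ℕ → O
    T^ = O.T O.^_
    hom : ∀ m n → T^ (m ℕ.+ n) O.≈ T^ m O.* T^ n
    hom = ᴼ.^-homo-* O.T
    a = pole x
    b = pole y
    c′ = pole z
    u = series x
    v = series y
    w = series z

  K-commutativeRing : CommutativeRing _ _
  K-commutativeRing = record
    { RawRing′
    ; isCommutativeRing = record
      { isRing = record
        { +-isAbelianGroup = record
          { isGroup = record
            { isMonoid = record
              { isSemigroup = record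
                { isMagma = record
                  { isEquivalence = Setoid.isEquivalence K.setoid
                  ; ∙-cong        = λ {x} {x′} {y} {y′} p r i →
                      trans (coeff-+ x y i) (trans (+-cong (p i) (r i)) (sym (coeff-+ x′ y′ i)))
                  }
                ; assoc = λ x y z i → begin
                    coeff (x K.+ y K.+ z) i             ≈⟨ trans (coeff-+ (x K.+ y) z i) (+-congʳ (coeff-+ x y i)) ⟩
                    coeff x i + coeff y i + coeff z i   ≈⟨ +-assoc _ _ _ ⟩
                    coeff x i + (coeff y i + coeff z i) ≈⟨ trans (coeff-+ x (y K.+ z) i) (+-congˡ (coeff-+ y z i)) ⟨
                    coeff (x K.+ (y K.+ z)) i           ∎
                }
              ; identity = +ᴷ-identityˡ , λ x i → trans (+ᴷ-comm x K.0# i) (+ᴷ-identityˡ x i)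
              }
            ; inverse = -ᴷ-inverseˡ , λ x i → trans (+ᴷ-comm x (K.- x) i) (-ᴷ-inverseˡ x i)
            ; ⁻¹-cong = λ {x} {y} p i → trans (coeff-neg x i) (trans (-‿cong (p i)) (sym (coeff-neg y i)))
            }
          ; comm = +ᴷ-comm
          }
        ; *-cong     = λ {x} {x′} {y} {y′} → *ᴷ-cong {x} {x′} {y} {y′}
        ; *-assoc    = λ x y z → T^-cong (ℕ.+-assoc (pole x) (pole y) (pole z)) (*ᴼ-assoc (series x) (series y) (series z))
        ; *-identity = *ᴷ-identityˡ , λ x i → trans (*ᴷ-comm x K.1# i) (*ᴷ-identityˡ x i)
        ; distrib    = (λ x y z i → trans (*ᴷ-comm x (y K.+ z) i) (trans (*ᴷ-distribʳ x y z i)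
                         (trans (coeff-+ (y K.* x) (z K.* x) i)
                           (trans (+-cong (*ᴷ-comm y x i) (*ᴷ-comm z x i)) (sym (coeff-+ (x K.* y) (x K.* z) i))))))
                     , *ᴷ-distribʳ
        }
      ; *-comm = *ᴷ-comm
      }
    }
    where
    module RawRing′ = RawRing K-rawRing

    +ᴷ-comm : ∀ x y → x K.+ y K.≈ y K.+ x
    +ᴷ-comm x y i = trans (coeff-+ x y i) (trans (+-comm _ _) (sym (coeff-+ y x i)))

    +ᴷ-identityˡ : ∀ x → K.0# K.+ x K.≈ x
    +ᴷ-identityˡ x i = trans (coeff-+ K.0# x i) (trans (+-congʳ (coeff-0 i)) (+-identityˡ _))

    -ᴷ-inverseˡ : ∀ x → (K.- x) K.+ x K.≈ K.0#
    -ᴷ-inverseˡ x i = trans (coeff-+ (K.- x) x i)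
      (trans (+-congʳ (coeff-neg x i)) (trans (-‿inverseˡ _) (sym (coeff-0 i))))

-- The expansion

-- Inequalities with equal differences are equivalent. Equality of the differences is a ring
-- identity, so every rearrangement of bounds below is left to the ring solver.
≤-transfer : ∀ {i j k l} → i ℤ.≤ j → k ℤ.- l ≡ i ℤ.- j → k ℤ.≤ l
≤-transfer i≤j k-l≡i-j = ℤ.i-j≤0⇒i≤j (≡.subst (ℤ._≤ + 0) (≡.sym k-l≡i-j) (ℤ.i≤j⇒i-j≤0 i≤j))

i≤∣i∣ : ∀ i → i ℤ.≤ + ℤ.∣ i ∣
i≤∣i∣ (+ n)    = ℤ.≤-refl
i≤∣i∣ -[1+ n ] = ℤ.-≤+

module Expansions {c ℓ q} (𝔽 : FiniteField c ℓ q) where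
  open LaurentSeries 𝔽 using (O; module O; constant; 𝒟; binomial)
  open PowerSeries 𝔽
  private module F = FiniteField 𝔽

  -- The part of the structure of K over O that the expansion needs; Ord x k
  -- stands for |x| ≤ q^-k.
  record FilteredAlgebra : Set (lsuc (c ⊔ ℓ)) where
    field
      commutativeRing : CommutativeRing c ℓ
    open PowersAndMultiples commutativeRing public
    infixr 8 _⊙_
    field
      ι         : O → Carrier
      ι-cong    : ∀ {x y} → x O.≈ y → ι x ≈ ι y
      ι-+       : ∀ x y → ι (x O.+ y) ≈ ι x + ι y
      ι-*       : ∀ x y → ι (x O.* y) ≈ ι x * ι y
      ι-1       : ι O.1# ≈ 1#
      _⊙_       : F.Carrier → Carrier → Carrier
      ⊙-*       : ∀ a x → a ⊙ x ≈ ι (constant a) * x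
      Ord       : Carrier → ℤ → Set ℓ
      Ord-cong  : ∀ {x y} k → x ≈ y → Ord x k → Ord y k
      Ord-mono  : ∀ {k l} x → k ℤ.≤ l → Ord x l → Ord x k
      Ord-0     : ∀ k → Ord 0# k
      Ord-+     : ∀ k x y → Ord x k → Ord y k → Ord (x + y) k
      Ord-neg   : ∀ k x → Ord x k → Ord (- x) k
      Ord-*     : ∀ k l x v → Ord x k → Vanishes l v → Ord (x * ι v) (k ℤ.+ + l)
      Ord-bound : ∀ x → ∃ λ M → Ord x (ℤ.- + M)
      separated : ∀ {x} → (∀ k → Ord x k) → x ≈ 0#

  module _ (A : FilteredAlgebra) where
    open FilteredAlgebra A
    open PascalArrays commutativeRing
    open NatSolver commutativeSemiring using (solve; _:=_; _:+_; _:*_)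
    open SetoidReasoning setoid
    open SemiringSum semiring using (sum)

    κ : F.Carrier → Carrier
    κ a = ι (constant a)

    additive⇒0 : (h : O → Carrier) → (∀ {x y} → x O.≈ y → h x ≈ h y) →
                 (∀ x y → h (x O.+ y) ≈ h x + h y) → h O.0# ≈ 0#
    additive⇒0 h h-cong h-+ = +-cancelˡ (h O.0#) _ _ (begin
      h O.0# + h O.0#      ≈⟨ h-+ O.0# O.0# ⟨
      h (O.0# O.+ O.0#)    ≈⟨ h-cong (λ n → F.+-identityˡ _) ⟩
      h O.0#               ≈⟨ +-identityʳ _ ⟨
      h O.0# + 0#          ∎)

    ι-^ : ∀ x n → ι x ^ n ≈ ι (x O.^ n)
    ι-^ x zero    = sym ι-1
    ι-^ x (suc n) = trans (*-congˡ (ι-^ x n)) (sym (ι-* x (x O.^ n)))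

    κ-* : ∀ a x → ι (a O.∙ x) ≈ κ a * ι x
    κ-* a x = trans (sym (ι-cong (constant-*ᴼ a x))) (ι-* (constant a) x)

    κ-1 : ∀ {a} → a F.≈ F.1# → κ a ≈ 1#
    κ-1 a≈1 = trans (ι-cong λ { zero → a≈1 ; (suc n) → F.refl }) ι-1

    κ-0 : ∀ {a} → a F.≈ F.0# → κ a ≈ 0#
    κ-0 a≈0 = trans (ι-cong λ { zero → a≈0 ; (suc n) → F.refl }) (additive⇒0 ι ι-cong ι-+)

    κ-+ : ∀ {a b c} → a F.≈ b F.+ c → κ a ≈ κ b + κ c
    κ-+ {a} {b} {c} a≈b+c = trans (ι-cong λ { zero → a≈b+c ; (suc n) → F.sym (F.+-identityˡ _) }) (ι-+ (constant b) (constant c))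

    Ord-Σ : ∀ k N g → (∀ i → i < N → Ord (g i) k) → Ord (Σ< N g) k
    Ord-Σ k zero    g _  = Ord-cong k (sym (Σ<-zero 0 λ _ ())) (Ord-0 k)
    Ord-Σ k (suc N) g og = Ord-cong k (sym (Σ<-last N g))
      (Ord-+ k _ _ (Ord-Σ k N g λ i i<N → og i (ℕ.m<n⇒m<1+n i<N)) (og N (ℕ.n<1+n N)))

    x-y+y≈x : ∀ x y → x - y + y ≈ x
    x-y+y≈x x y = trans (+-assoc _ _ _) (trans (+-congˡ (-‿inverseˡ y)) (+-identityʳ x))

    separated-≈ : ∀ {x y} → (∀ k → Ord (x - y) k) → x ≈ y
    separated-≈ {x} {y} ord = trans (sym (x-y+y≈x x y)) (trans (+-congʳ (separated ord)) (+-identityˡ y))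

    -- Any ring homomorphism turns the Leibniz rule into the Pascal recursion. It is applied to `ι`,
    -- where a is T, and to the q^m-th power of `ι`, where a is W.
    𝒟-isPascal : (φ : O → Carrier) → (∀ {x y} → x O.≈ y → φ x ≈ φ y) →
                 (∀ x y → φ (x O.+ y) ≈ φ x + φ y) → (∀ x y → φ (x O.* y) ≈ φ x * φ y) →
                 φ O.1# ≈ 1# → IsPascal (φ O.T) λ j k → φ (𝒟 k (O.T O.^ j))
    𝒟-isPascal φ φ-cong φ-+ φ-* φ-1 = record
      { origin = trans (φ-cong (𝒟₀ O.1#)) φ-1
      ; row    = λ k → trans (φ-cong (𝒟-1 k)) (additive⇒0 φ φ-cong φ-+)
      ; column = λ j → begin
          φ (𝒟 0 (O.T O.* O.T O.^ j))      ≈⟨ φ-cong (𝒟₀ (O.T O.* O.T O.^ j)) ⟩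
          φ (O.T O.* O.T O.^ j)            ≈⟨ φ-* O.T (O.T O.^ j) ⟩
          φ O.T * φ (O.T O.^ j)            ≈⟨ *-congˡ (φ-cong (𝒟₀ (O.T O.^ j))) ⟨
          φ O.T * φ (𝒟 0 (O.T O.^ j))      ∎
      ; step   = λ j k → begin
          φ (𝒟 (suc k) (O.T O.* O.T O.^ j))
            ≈⟨ φ-cong (𝒟-T k (O.T O.^ j)) ⟩
          φ (𝒟 k (O.T O.^ j) O.+ O.T O.* 𝒟 (suc k) (O.T O.^ j))
            ≈⟨ φ-+ (𝒟 k (O.T O.^ j)) (O.T O.* 𝒟 (suc k) (O.T O.^ j)) ⟩
          φ (𝒟 k (O.T O.^ j)) + φ (O.T O.* 𝒟 (suc k) (O.T O.^ j))
            ≈⟨ +-congˡ (φ-* O.T (𝒟 (suc k) (O.T O.^ j))) ⟩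
          φ (𝒟 k (O.T O.^ j)) + φ O.T * φ (𝒟 (suc k) (O.T O.^ j))
            ∎
      }

    binomial-isPascal : ∀ M → IsPascal M λ n j → κ (binomial n j) * M ^ (n ∸ j)
    binomial-isPascal M = record
      { origin = trans (*-identityʳ _) (κ-1 (binomial-zero 0))
      ; row    = λ k → trans (*-congʳ (κ-0 (binomial-< {0} {suc k} z<s))) (zeroˡ _)
      ; column = λ n → begin
          κ (binomial (suc n) 0) * (M * M ^ n) ≈⟨ *-congʳ (trans (κ-1 (binomial-zero (suc n))) (sym (κ-1 (binomial-zero n)))) ⟩
          κ (binomial n 0) * (M * M ^ n)       ≈⟨ solve 3 (λ x y z → x :* (y :* z) := y :* (x :* z)) refl _ _ _ ⟩
          M * (κ (binomial n 0) * M ^ n)       ∎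
      ; step   = λ n k → begin
          κ (binomial (suc n) (suc k)) * M ^ (n ∸ k)
            ≈⟨ *-congʳ (κ-+ (binomial-pascal n k)) ⟩
          (κ (binomial n k) + κ (binomial n (suc k))) * M ^ (n ∸ k)
            ≈⟨ distribʳ _ _ _ ⟩
          κ (binomial n k) * M ^ (n ∸ k) + κ (binomial n (suc k)) * M ^ (n ∸ k)
            ≈⟨ +-congˡ (raise n k) ⟩
          κ (binomial n k) * M ^ (n ∸ k) + M * (κ (binomial n (suc k)) * M ^ (n ∸ suc k))
            ∎
      }
      where
      raise : ∀ n k → κ (binomial n (suc k)) * M ^ (n ∸ k) ≈ M * (κ (binomial n (suc k)) * M ^ (n ∸ suc k))
      raise n k with n ℕ.≤? k
      -- Truncated subtraction keeps both exponents at 0, but C(n , k + 1) = 0 annihilates both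
      -- sides.
      ... | yes n≤k = begin
        κ (binomial n (suc k)) * M ^ (n ∸ k)                 ≈⟨ trans (*-congʳ κ≈0) (zeroˡ _) ⟩
        0#                                                   ≈⟨ trans (*-congˡ (trans (*-congʳ κ≈0) (zeroˡ _))) (zeroʳ _) ⟨
        M * (κ (binomial n (suc k)) * M ^ (n ∸ suc k))       ∎
        where κ≈0 = κ-0 (binomial-< (s≤s n≤k))
      ... | no n≰k = begin
        κ (binomial n (suc k)) * M ^ (n ∸ k)                 ≈⟨ *-congˡ (^-congʳ M (ℕ.+-∸-assoc 1 (ℕ.≰⇒> n≰k))) ⟩
        κ (binomial n (suc k)) * (M * M ^ (n ∸ suc k))       ≈⟨ solve 3 (λ x y z → x :* (y :* z) := y :* (x :* z)) refl _ _ _ ⟩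
        M * (κ (binomial n (suc k)) * M ^ (n ∸ suc k))       ∎

    -- B n i plays the role of ((Δ - [m]I)ⁿ f)(Tⁱ).
    module Coefficients
      (q-primePower : IsPrimePower q) (m : ℕ)
      (f : O → Carrier)
      (f-cong : ∀ {x y} → x O.≈ y → f x ≈ f y)
      (f-+ : ∀ x y → f (x O.+ y) ≈ f x + f y)
      (f-∙ : ∀ a x → f (a O.∙ x) ≈ a ⊙ f x)
      (f-continuous : ∀ x k → ∃ λ l → ∀ y → (∀ n → n < l → y n F.≈ x n) → Ord (f y - f x) k)
      (B : ℕ → ℕ → Carrier)
      (B-zero : ∀ i → B 0 i ≈ f (O.T O.^ i))
      (B-Δ : ∀ n i → B (suc n) i ≈ B n (suc i) - ι O.T * B n i - (ι O.T ^ (q ℕ.^ m) - ι O.T) * B n i)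
      where

      φ : O → Carrier
      φ x = ι x ^ (q ℕ.^ m)

      W : Carrier
      W = φ O.T

      φ-ι : ∀ x → φ x ≈ ι (x O.^ (q ℕ.^ m))
      φ-ι x = ι-^ x (q ℕ.^ m)

      φ-cong : ∀ {x y} → x O.≈ y → φ x ≈ φ y
      φ-cong x≈y = ^-congˡ (q ℕ.^ m) (ι-cong x≈y)

      φ-+ : ∀ x y → φ (x O.+ y) ≈ φ x + φ y
      φ-+ x y = begin
        φ (x O.+ y)                                    ≈⟨ φ-ι (x O.+ y) ⟩
        ι ((x O.+ y) O.^ (q ℕ.^ m))                    ≈⟨ ι-cong (^q^m-+ q-primePower m x y) ⟩
        ι (x O.^ (q ℕ.^ m) O.+ y O.^ (q ℕ.^ m))        ≈⟨ ι-+ _ _ ⟩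
        ι (x O.^ (q ℕ.^ m)) + ι (y O.^ (q ℕ.^ m))      ≈⟨ +-cong (φ-ι x) (φ-ι y) ⟨
        φ x + φ y                                      ∎

      φ-* : ∀ x y → φ (x O.* y) ≈ φ x * φ y
      φ-* x y = trans (^-congˡ (q ℕ.^ m) (ι-* x y)) (^-distrib-* (ι x) (ι y) (q ℕ.^ m))

      φ-1 : φ O.1# ≈ 1#
      φ-1 = trans (^-congˡ (q ℕ.^ m) ι-1) (1^n≈1 (q ℕ.^ m))
        where
        1^n≈1 : ∀ n → 1# ^ n ≈ 1#
        1^n≈1 zero    = refl
        1^n≈1 (suc n) = trans (*-identityˡ _) (1^n≈1 n)

      φ-∙ : ∀ a x → φ (a O.∙ x) ≈ κ a * φ x
      φ-∙ a x = begin
        φ (a O.∙ x)                     ≈⟨ φ-ι (a O.∙ x) ⟩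
        ι ((a O.∙ x) O.^ (q ℕ.^ m))     ≈⟨ ι-cong (^q^m-∙ m a x) ⟩
        ι (a O.∙ x O.^ (q ℕ.^ m))       ≈⟨ κ-* a (x O.^ (q ℕ.^ m)) ⟩
        κ a * ι (x O.^ (q ℕ.^ m))       ≈⟨ *-congˡ (φ-ι x) ⟨
        κ a * φ x                       ∎

      φ-Vanishes : ∀ {l x} → Vanishes l x → ∃ λ y → φ x ≈ ι y × Vanishes l y
      φ-Vanishes {l} {x} vx = x O.^ (q ℕ.^ m) , φ-ι x ,
        ≡.subst (λ N → Vanishes l (x O.^ N)) (≡.sym (proj₂ (q^m≡suc m))) (Vanishes-^ (proj₁ (q^m≡suc m)) vx)

      Ord-*φ : ∀ k l x v → Ord x k → Vanishes l v → Ord (x * φ v) (k ℤ.+ + l)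
      Ord-*φ k l x v ox vv with φ-Vanishes vv
      ... | w , φv≈ιw , vw = Ord-cong (k ℤ.+ + l) (*-congˡ (sym φv≈ιw)) (Ord-* k l x w ox vw)

      β : ℕ → Carrier
      β n = B n 0

      term : (ℕ → Carrier) → O → ℕ → Carrier
      term γ x n = γ n * φ (𝒟 n x)

      isPascal-φ : IsPascal W λ j k → φ (𝒟 k (O.T O.^ j))
      isPascal-φ = 𝒟-isPascal φ φ-cong φ-+ φ-* φ-1

      S : (ℕ → Carrier) → ℕ → O → Carrier
      S γ N x = Σ< N (term γ x)

      S-cong : ∀ γ N {x y} → x O.≈ y → S γ N x ≈ S γ N y
      S-cong γ N x≈y = Σ<-cong N λ n → *-congˡ (φ-cong (𝒟-cong n x≈y))

      S-+ : ∀ γ N x y → S γ N (x O.+ y) ≈ S γ N x + S γ N y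
      S-+ γ N x y = trans
        (Σ<-cong N λ n → trans (*-congˡ (trans (φ-cong (𝒟-+ n x y)) (φ-+ (𝒟 n x) (𝒟 n y)))) (distribˡ _ _ _))
        (Σ<-+ N _ _)

      S-∙ : ∀ γ N a x → S γ N (a O.∙ x) ≈ κ a * S γ N x
      S-∙ γ N a x = trans
        (Σ<-cong N λ n → trans (*-congˡ (trans (φ-cong (𝒟-∙ n a x)) (φ-∙ a (𝒟 n x))))
          (solve 3 (λ x y z → x :* (y :* z) := y :* (x :* z)) refl _ _ _))
        (sym (Σ<-*ˡ N _ _))

      B-suc : ∀ n i → B (suc n) i ≈ B n (suc i) - W * B n i
      B-suc n i = begin
        B (suc n) i                                    ≈⟨ B-Δ n i ⟩
        B n (suc i) - t * b - (W - t) * b              ≈⟨ +-assoc _ _ _ ⟩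
        B n (suc i) + (- (t * b) - (W - t) * b)        ≈⟨ +-congˡ (-‿+-comm _ _) ⟩
        B n (suc i) - (t * b + (W - t) * b)            ≈⟨ +-congˡ (-‿cong (distribʳ b t (W - t))) ⟨
        B n (suc i) - (t + (W - t)) * b                ≈⟨ +-congˡ (-‿cong (*-congʳ (trans (+-comm _ _) (x-y+y≈x W t)))) ⟩
        B n (suc i) - W * b                            ∎
        where
        t = ι O.T
        b = B n i

      B-shift : ∀ n i → B n (suc i) ≈ B (suc n) i + W * B n i
      B-shift n i = trans (sym (x-y+y≈x (B n (suc i)) (W * B n i))) (+-congʳ (sym (B-suc n i)))

      S-T^ : ∀ {N} j → j < N → S β N (O.T O.^ j) ≈ f (O.T O.^ j)
      S-T^ {N} j j<N = begin
        S β N (O.T O.^ j)                              ≈⟨ Σ<-cong N (λ k → *-comm _ _) ⟩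
        -- The two indices of `B` are exchanged here: `B-shift` expresses a step in the exponent of
        -- T as shift + W acting on the power of the operator.
        Σ< N (λ k → φ (𝒟 k (O.T O.^ j)) * B k 0)       ≈⟨ IsPascal.transform isPascal-φ (λ i n → B n i) (λ i n → B-shift n i) N j 0 j<N ⟨
        B 0 j                                          ≈⟨ B-zero j ⟩
        f (O.T O.^ j)                                  ∎

      S-truncate : ∀ {N} L x → L ≤ N → S β N (truncate L x) ≈ f (truncate L x)
      S-truncate {N} zero    x _   = trans (additive⇒0 (S β N) (S-cong β N) (S-+ β N)) (sym (additive⇒0 f f-cong f-+))
      S-truncate {N} (suc L) x L<N = begin
        S β N (truncate L x O.+ x L O.∙ O.T O.^ L)
          ≈⟨ trans (S-+ β N (truncate L x) (x L O.∙ O.T O.^ L)) (+-congˡ (S-∙ β N (x L) (O.T O.^ L))) ⟩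
        S β N (truncate L x) + κ (x L) * S β N (O.T O.^ L)
          ≈⟨ +-cong (S-truncate L x (ℕ.<⇒≤ L<N)) (*-congˡ (S-T^ L L<N)) ⟩
        f (truncate L x) + κ (x L) * f (O.T O.^ L)
          ≈⟨ trans (f-+ (truncate L x) (x L O.∙ O.T O.^ L)) (+-congˡ (trans (f-∙ (x L) (O.T O.^ L)) (⊙-* (x L) (f (O.T O.^ L))))) ⟨
        f (truncate L x O.+ x L O.∙ O.T O.^ L)
          ∎

      commonBound : ∀ (g : ℕ → Carrier) l → ∃ λ M → ∀ i → i < l → Ord (g i) (ℤ.- + M)
      commonBound g zero    = 0 , λ _ ()
      commonBound g (suc l) with commonBound g l | Ord-bound (g l)
      ... | M , oM | M′ , oM′ = M ℕ.⊔ M′ , λ i i<1+l → combine i (i ℕ.≟ l) i<1+l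
        where
        combine : ∀ i → Dec (i ≡ l) → i < suc l → Ord (g i) (ℤ.- + (M ℕ.⊔ M′))
        combine i (yes ≡.refl) _ = Ord-mono (g l) (ℤ.neg-mono-≤ (ℤ.+≤+ (ℕ.m≤n⊔m M M′))) oM′
        combine i (no i≢l) i<1+l = Ord-mono (g i) (ℤ.neg-mono-≤ (ℤ.+≤+ (ℕ.m≤m⊔n M M′)))
          (oM i (ℕ.≤∧≢⇒< (s≤s⁻¹ i<1+l) i≢l))

      fT^⟶0 : ∀ k → ∃ λ l → ∀ i → l ≤ i → Ord (f (O.T O.^ i)) k
      fT^⟶0 k with f-continuous O.0# k
      ... | l , close = l , λ i l≤i → Ord-cong k
        (trans (+-congˡ (trans (-‿cong (additive⇒0 f f-cong f-+)) -0#≈0#)) (+-identityʳ _))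
        (close (O.T O.^ i) λ n n<l → T^-≢ i n (ℕ.<⇒≢ (ℕ.<-≤-trans n<l l≤i)))

      -- ord (B n i) ≥ min (k , n + i - C)
      B-bound : ∀ k → ∃ λ C → ∀ n i j → j ℤ.≤ k → j ℤ.+ + C ℤ.≤ + (n ℕ.+ i) → Ord (B n i) j
      B-bound k with fT^⟶0 k
      ... | l , small with commonBound (λ i → f (O.T O.^ i)) l
      -- From `l` on, f(Tⁱ) has order k. Below `l` only order -M is known, and there j + M + l ≤ i <
      -- l forces j ≤ -M.
      ... | M , bounded = M ℕ.+ l , bound
        where
        C = M ℕ.+ l

        initial : ∀ i j → j ℤ.≤ k → j ℤ.+ + C ℤ.≤ + i → Dec (l ≤ i) → Ord (f (O.T O.^ i)) j
        initial i j j≤k j+C≤i (yes l≤i) = Ord-mono (f (O.T O.^ i)) j≤k (small i l≤i)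
        initial i j j≤k j+C≤i (no l≰i)  = Ord-mono (f (O.T O.^ i)) j≤-M (bounded i (ℕ.≰⇒> l≰i))
          where
          j≤-M : j ℤ.≤ ℤ.- + M
          j≤-M = ≤-transfer (ℤ.≤-trans j+C≤i (ℤ.+≤+ (ℕ.<⇒≤ (ℕ.≰⇒> l≰i)))) (difference j (+ M) (+ l))
            where
            difference : ∀ j M l → j ℤ.- ℤ.- M ≡ j ℤ.+ (M ℤ.+ l) ℤ.- l
            difference = ℤ-Solver.solve-∀

        T-Vanishes : Vanishes 1 O.T
        T-Vanishes zero    _        = F.refl
        T-Vanishes (suc n) (s≤s ())

        bound : ∀ n i j → j ℤ.≤ k → j ℤ.+ + C ℤ.≤ + (n ℕ.+ i) → Ord (B n i) j
        bound zero    i j j≤k j+C≤i = Ord-cong j (sym (B-zero i)) (initial i j j≤k j+C≤i (l ℕ.≤? i))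
        -- The first summand trades a step in `n` for one in `i`. In the second, W supplies one unit
        -- of order, so `B n i` is needed only to order j - 1; this is why `j` varies below the
        -- fixed `k`.
        bound (suc n) i j j≤k j+C≤ = Ord-cong j (sym (B-suc n i))
          (Ord-+ j _ _ (bound n (suc i) j j≤k (≡.subst (λ s → j ℤ.+ + C ℤ.≤ + s) (≡.sym (ℕ.+-suc n i)) j+C≤))
            (Ord-neg j _ (Ord-cong j (*-comm _ _)
              (≡.subst (Ord (B n i * W)) (j-1+1 j) (Ord-*φ (j ℤ.- + 1) 1 (B n i) O.T previous T-Vanishes)))))
          where
          j-1+1 : ∀ j → j ℤ.- + 1 ℤ.+ + 1 ≡ j
          j-1+1 = ℤ-Solver.solve-∀

          difference : ∀ j C n → j ℤ.- + 1 ℤ.+ C ℤ.- n ≡ j ℤ.+ C ℤ.- (+ 1 ℤ.+ n)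
          difference = ℤ-Solver.solve-∀

          previous : Ord (B n i) (j ℤ.- + 1)
          previous = bound n i (j ℤ.- + 1) (ℤ.≤-trans (ℤ.i-j≤i j (+ 1)) j≤k)
            (≤-transfer j+C≤ (difference j (+ C) (+ (n ℕ.+ i))))

      β-bound : ∀ k → ∃ λ C → ∀ n j → j ℤ.≤ k → j ℤ.+ + C ℤ.≤ + n → Ord (β n) j
      β-bound k with B-bound k
      ... | C , bound = C , λ n j j≤k j+C≤n →
        bound n 0 j j≤k (≡.subst (λ s → j ℤ.+ + C ℤ.≤ + s) (≡.sym (ℕ.+-identityʳ n)) j+C≤n)

      β⟶0 : ∀ k → ∃ λ N → ∀ n → N ≤ n → Ord (β n - 0#) k
      β⟶0 k with β-bound k
      ... | C , bound = ℤ.∣ k ℤ.+ + C ∣ , λ n N≤n →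
        Ord-cong k (sym (trans (+-congˡ -0#≈0#) (+-identityʳ _)))
          (bound n k ℤ.≤-refl (ℤ.≤-trans (i≤∣i∣ (k ℤ.+ + C)) (ℤ.+≤+ N≤n)))

      -- As `𝒟 i z` has order at least n - i, it suffices that `β i` has order k - (n - i). The
      -- condition in `β-bound` for this, k - (n - i) + C ≤ i, amounts to k + C ≤ n, so one
      -- threshold serves all `i`.
      S-Vanishes : ∀ k → ∃ λ N → ∀ n → N ≤ n → ∀ z → Vanishes n z → Ord (S β n z) k
      S-Vanishes k with β-bound k
      ... | C , bound = ℤ.∣ k ℤ.+ + C ∣ , λ n N≤n z vz → Ord-Σ k n (term β z) λ i i<n →
        ≡.subst (Ord (term β z i)) (k-d+d k (+ (n ∸ i)))
          (Ord-*φ (k ℤ.- + (n ∸ i)) (n ∸ i) (β i) (𝒟 i z)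
            (bound i (k ℤ.- + (n ∸ i)) (ℤ.i-j≤i k (+ (n ∸ i)))
              (≤-transfer
                (ℤ.≤-trans (ℤ.≤-trans (i≤∣i∣ (k ℤ.+ + C)) (ℤ.+≤+ N≤n))
                           (ℤ.≤-reflexive (≡.cong +_ (≡.sym (ℕ.m+[n∸m]≡n (ℕ.<⇒≤ i<n))))))
                (difference k (+ C) (+ i) (+ (n ∸ i)))))
            (𝒟-Vanishes i (ℕ.<⇒≤ i<n) vz))
        where
        k-d+d : ∀ k d → k ℤ.- d ℤ.+ d ≡ k
        k-d+d = ℤ-Solver.solve-∀

        difference : ∀ k C i d → k ℤ.- d ℤ.+ C ℤ.- i ≡ k ℤ.+ C ℤ.- (i ℤ.+ d)
        difference = ℤ-Solver.solve-∀

      Converges : (ℕ → Carrier) → Set (c ⊔ ℓ)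
      Converges γ = ∀ x k → ∃ λ N → ∀ n → N ≤ n → Ord (sum {n} (λ i → term γ x (toℕ i)) - f x) k

      -- The sum of n terms is exact at truncate n x, and the terms of index i < n
      -- at the remainder z have order at least ord (β i) + n - i.
      expansion : Converges β
      expansion x k with S-Vanishes k | f-continuous x k
      ... | N , small | l , close = N ℕ.⊔ l , λ n N⊔l≤n →
        let y = truncate n x
            z = λ i → x i F.- y i
        in Ord-cong k (sym (begin
             sum {n} (λ i → term β x (toℕ i)) - f x ≡⟨ ≡.cong (_- f x) (Σ<-sum n (term β x)) ⟨
             S β n x - f x                      ≈⟨ +-congʳ (S-cong β n λ i → x≈[x-y]+y (x i) (y i)) ⟩
             S β n (z O.+ y) - f x              ≈⟨ +-congʳ (S-+ β n z y) ⟩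
             S β n z + S β n y - f x            ≈⟨ +-congʳ (+-congˡ (S-truncate n x ℕ.≤-refl)) ⟩
             S β n z + f y - f x                ≈⟨ +-assoc _ _ _ ⟩
             S β n z + (f y - f x)              ∎))
           (Ord-+ k (S β n z) (f y - f x)
             (small n (ℕ.≤-trans (ℕ.m≤m⊔n N l) N⊔l≤n) z
               (λ i i<n → F.trans (F.+-congˡ (F.-‿cong (truncate-< n x i i<n))) (F.-‿inverseʳ (x i))))
             (close y λ i i<l → truncate-< n x i (ℕ.<-≤-trans i<l (ℕ.≤-trans (ℕ.m≤n⊔m N l) N⊔l≤n))))
        where
        x≈[x-y]+y : ∀ a b → a F.≈ (a F.- b) F.+ b
        x≈[x-y]+y a b = F.sym (F.trans (F.+-assoc _ _ _) (F.trans (F.+-congˡ (F.-‿inverseˡ b)) (F.+-identityʳ a)))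

      -- At `T^j` all terms of index above `j` vanish, so the partial sums are constant from j + 1
      -- terms on, and a constant sequence equals its limit because the filtration is separated.
      expansion-T^ : ∀ γ → Converges γ →
                     ∀ j → S γ (suc j) (O.T O.^ j) ≈ f (O.T O.^ j)
      expansion-T^ γ γ-expansion j = separated-≈ λ k →
        let N , close = γ-expansion (O.T O.^ j) k
        in Ord-cong k (+-congʳ (trans (reflexive (≡.sym (Σ<-sum (N ℕ.⊔ suc j) (term γ (O.T O.^ j)))))
             (Σ<-extend (term γ (O.T O.^ j)) (ℕ.m≤n⊔m N (suc j)) λ n j<n →
               trans (*-congˡ (IsPascal.vanish isPascal-φ j n j<n)) (zeroʳ _))))
           (close (N ℕ.⊔ suc j) (ℕ.m≤m⊔n N (suc j)))

      unique : ∀ γ → Converges γ → ∀ n → γ n ≈ β n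
      unique γ γ-expansion = IsPascal.Σ-injective isPascal-φ γ β λ j → begin
        Σ< (suc j) (λ k → φ (𝒟 k (O.T O.^ j)) * γ k) ≈⟨ Σ<-cong (suc j) (λ k → *-comm _ _) ⟩
        S γ (suc j) (O.T O.^ j)                      ≈⟨ expansion-T^ γ γ-expansion j ⟩
        f (O.T O.^ j)                                ≈⟨ S-T^ j (ℕ.n<1+n j) ⟨
        S β (suc j) (O.T O.^ j)                      ≈⟨ Σ<-cong (suc j) (λ k → *-comm _ _) ⟩
        Σ< (suc j) (λ k → φ (𝒟 k (O.T O.^ j)) * β k) ∎

      β-formula : ∀ n → β n ≈ sum {suc n} λ i′ → let i = toℕ i′ in sum {suc n ∸ i} λ k → let j = i ℕ.+ toℕ k in
        (- 1#) ^ (n ∸ i) * (binomial n j ⊙ (W - ι O.T) ^ (n ∸ j)) * f (O.T O.^ i) * ι (𝒟 i (O.T O.^ j))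
      β-formula n = begin
        B n 0
          ≈⟨ IsPascal.transform isPascal B B-step (suc n) n 0 (ℕ.n<1+n n) ⟩
        Σ< (suc n) (λ i → (- 1#) ^ (n ∸ i) * PQ n i * B 0 i)
          ≈⟨ Σ<-cong (suc n) (λ i → trans (*-congˡ (B-zero i)) (inner i)) ⟩
        Σ< (suc n) (λ i → sum {suc n ∸ i} λ k → summand i (i ℕ.+ toℕ k))
          ≡⟨ Σ<-sum (suc n) (λ i → sum {suc n ∸ i} λ k → summand i (i ℕ.+ toℕ k)) ⟩
        sum {suc n} (λ i → sum {suc n ∸ toℕ i} λ k → summand (toℕ i) (toℕ i ℕ.+ toℕ k))
          ∎
        where
        M : Carrier
        M = W - ι O.T

        P Q PQ summand : ℕ → ℕ → Carrier
        P n j = κ (binomial n j) * M ^ (n ∸ j)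
        Q j i = ι (𝒟 i (O.T O.^ j))
        PQ n i = Σ< (suc n) λ j → P n j * Q j i
        summand i j = (- 1#) ^ (n ∸ i) * (binomial n j ⊙ M ^ (n ∸ j)) * f (O.T O.^ i) * Q j i

        isPascal-Q : IsPascal (ι O.T) Q
        isPascal-Q = 𝒟-isPascal ι ι-cong ι-+ ι-* ι-1

        -- `P` belongs to [m] and `Q` to T, so their product belongs to [m] + T = W and the signs
        -- turn W into -W, the constant in the recursion of `B` in `n`. The product over the middle
        -- index `j` is the inner sum of the formula.
        isPascal : IsPascal (- (M + ι O.T)) λ n i → (- 1#) ^ (n ∸ i) * PQ n i
        isPascal = signed-isPascal (product-isPascal (binomial-isPascal M) isPascal-Q)

        B-step : ∀ n i → B (suc n) i ≈ B n (suc i) + - (M + ι O.T) * B n i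
        B-step n i = trans (B-suc n i) (+-congˡ (trans (-‿distribˡ-* _ _) (*-congʳ (-‿cong (sym (x-y+y≈x W (ι O.T)))))))

        inner : ∀ i → (- 1#) ^ (n ∸ i) * PQ n i * f (O.T O.^ i) ≈ sum {suc n ∸ i} λ k → summand i (i ℕ.+ toℕ k)
        inner i = begin
          (- 1#) ^ (n ∸ i) * PQ n i * f (O.T O.^ i)
            ≈⟨ solve 3 (λ s x f → s :* x :* f := (s :* f) :* x) refl _ _ _ ⟩
          ((- 1#) ^ (n ∸ i) * f (O.T O.^ i)) * PQ n i
            ≈⟨ Σ<-*ˡ (suc n) _ _ ⟩
          Σ< (suc n) (λ j → ((- 1#) ^ (n ∸ i) * f (O.T O.^ i)) * (P n j * Q j i))
            ≈⟨ Σ<-cong (suc n) (λ j → trans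
                 (solve 4 (λ s f p q → (s :* f) :* (p :* q) := s :* p :* f :* q) refl _ _ _ _)
                 (*-congʳ (*-congʳ (*-congˡ (sym (⊙-* (binomial n j) (M ^ (n ∸ j)))))))) ⟩
          Σ< (suc n) (summand i)
            ≈⟨ Σ<-drop i (suc n) (summand i) (λ j j<i → trans (*-congˡ (IsPascal.vanish isPascal-Q j i j<i)) (zeroʳ _)) ⟨
          sum {suc n ∸ i} (λ k → summand i (i ℕ.+ toℕ k))
            ∎

-- The T-adic filtration of K

module LaurentFiltration {c ℓ q} (𝔽 : FiniteField c ℓ q) where
  open LaurentSeries 𝔽
  open PowerSeries 𝔽
  open LaurentRing 𝔽
  open Expansions 𝔽
  open FiniteField 𝔽
  open RingProperties ring using (-0#≈0#)
  open SemiringSum semiring using (sum-cong-≋; sum-replicate-zero)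

  ι-+ : ∀ x y → ι (x O.+ y) K.≈ ι x K.+ ι y
  ι-+ x y i = trans (extend-+ x y (i ℤ.+ + 0)) (sym (coeff-+ (ι x) (ι y) i))

  -- In each product of coefficients `u j * v (n ∸ j)` one factor is zero: if j < k + s the first
  -- is, by the bound on x; otherwise n < k + l + s gives n - j < l and the second is.
  ∣∣-* : ∀ k l x v → ∣ x ∣≤q^- k → Vanishes l v → ∣ x K.* ι v ∣≤q^- (k ℤ.+ + l)
  ∣∣-* k l (T^- s ∙ u) v ∣x∣≤ vv i i<k+l = extend-≈0 (i ℤ.+ + (s ℕ.+ 0))
    (≡.subst (i ℤ.+ + (s ℕ.+ 0) ℤ.<_) (≡.cong (λ t → k ℤ.+ + l ℤ.+ + t) (ℕ.+-identityʳ s))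
      (ℤ.+-monoˡ-< (+ (s ℕ.+ 0)) i<k+l))
    where
    j-s+s : ∀ j s → j ℤ.- s ℤ.+ s ≡ j
    j-s+s = ℤ-Solver.solve-∀

    k+s-s : ∀ k s → k ℤ.+ s ℤ.- s ≡ k
    k+s-s = ℤ-Solver.solve-∀

    k+l+s : ∀ k l s → k ℤ.+ l ℤ.+ s ≡ k ℤ.+ s ℤ.+ l
    k+l+s = ℤ-Solver.solve-∀

    extend-≈0 : ∀ z → z ℤ.< k ℤ.+ + l ℤ.+ + s → extend (u O.* v) z ≈ 0#
    extend-≈0 -[1+ n ] _ = refl
    extend-≈0 (+ n) n<k+l+s = trans (sum-cong-≋ {suc n} λ j → product≈0 (toℕ j) (s≤s⁻¹ (Fin.toℕ<n j)) (+ toℕ j ℤ.<? k ℤ.+ + s))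
      (sum-replicate-zero (suc n))
      where
      product≈0 : ∀ j → j ≤ n → Dec (+ j ℤ.< k ℤ.+ + s) → u j * v (n ∸ j) ≈ 0#
      product≈0 j j≤n (yes j<k+s) = trans (*-congʳ (≡.subst (λ z → extend u z ≈ 0#) (j-s+s (+ j) (+ s))
        (∣x∣≤ (+ j ℤ.- + s) (≡.subst (+ j ℤ.- + s ℤ.<_) (k+s-s k (+ s)) (ℤ.+-monoˡ-< (ℤ.- + s) j<k+s))))) (zeroˡ _)
      product≈0 j j≤n (no j≮k+s) = trans (*-congˡ (vv (n ∸ j) (ℕ.+-cancelˡ-< j (n ∸ j) l
        (≡.subst (ℕ._< j ℕ.+ l) (≡.sym (ℕ.m+[n∸m]≡n j≤n)) (ℤ.drop‿+<+ n<j+l))))) (zeroʳ _)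
        where
        n<j+l : + n ℤ.< + (j ℕ.+ l)
        n<j+l = ℤ.<-≤-trans (≡.subst (+ n ℤ.<_) (k+l+s k (+ l) (+ s)) n<k+l+s)
          (ℤ.+-monoˡ-≤ (+ l) (ℤ.≮⇒≥ j≮k+s))

  ∣∣-bound : ∀ x → ∣ x ∣≤q^- (ℤ.- + pole x)
  ∣∣-bound (T^- s ∙ u) i i<-s = extend-Vanishes 0 u (i ℤ.+ + s) (λ _ ())
    (≡.subst (i ℤ.+ + s ℤ.<_) (ℤ.+-inverseˡ (+ s)) (ℤ.+-monoˡ-< (+ s) i<-s))

  K-filteredAlgebra : FilteredAlgebra
  K-filteredAlgebra = record
    { commutativeRing = K-commutativeRing
    ; ι         = ι
    ; ι-cong    = T^-cong ≡.refl
    ; ι-+       = ι-+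
    ; ι-*       = λ x y i → refl
    ; ι-1       = λ i → refl
    ; _⊙_       = K._∙_
    ; ⊙-*       = λ { a (T^- s ∙ u) → T^-cong ≡.refl λ n → sym (constant-*ᴼ a u n) }
    ; Ord       = ∣_∣≤q^-_
    ; Ord-cong  = λ k x≈y ∣x∣≤ i i<k → trans (sym (x≈y i)) (∣x∣≤ i i<k)
    ; Ord-mono  = λ x k≤l ∣x∣≤ i i<k → ∣x∣≤ i (ℤ.<-≤-trans i<k k≤l)
    ; Ord-0     = λ k i _ → coeff-0 i
    ; Ord-+     = λ k x y ∣x∣≤ ∣y∣≤ i i<k → trans (coeff-+ x y i) (trans (+-cong (∣x∣≤ i i<k) (∣y∣≤ i i<k)) (+-identityˡ 0#))
    ; Ord-neg   = λ k x ∣x∣≤ i i<k → trans (coeff-neg x i) (trans (-‿cong (∣x∣≤ i i<k)) -0#≈0#)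
    ; Ord-*     = ∣∣-*
    ; Ord-bound = λ x → pole x , ∣∣-bound x
    ; separated = λ ∣x∣≤ i → trans (∣x∣≤ (ℤ.suc i) i (ℤ.suc[i]≤j⇒i<j ℤ.≤-refl)) (sym (coeff-0 i))
    }

  -- The modulus given by continuity is an integer, possibly negative. Elements of `O` have no
  -- coefficients of negative index, so agreement below the natural number `∣ l ∣`, which is at
  -- least `l`, suffices.
  continuous⇒close : ∀ f → Continuous f → ∀ x k → ∃ λ l → ∀ y → (∀ n → n < l → y n ≈ x n) → ∣ f y K.- f x ∣≤q^- k
  continuous⇒close f f-continuous x k with f-continuous x k
  ... | l , close = ℤ.∣ l ∣ , λ y y≈x → close y λ i i<l → begin
    coeff (ι y K.- ι x) i               ≈⟨ coeff-+ (ι y) (K.- ι x) i ⟩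
    coeff (ι y) i + coeff (K.- ι x) i   ≈⟨ +-cong (agree i (ℤ.<-≤-trans i<l (i≤∣i∣ l)) y y≈x) (coeff-neg (ι x) i) ⟩
    coeff (ι x) i - coeff (ι x) i       ≈⟨ -‿inverseʳ _ ⟩
    0#                                  ∎
    where
    open SetoidReasoning setoid
    agree : ∀ i → i ℤ.< + ℤ.∣ l ∣ → ∀ y → (∀ n → n < ℤ.∣ l ∣ → y n ≈ x n) → coeff (ι y) i ≈ coeff (ι x) i
    agree (+ n)    (ℤ.+<+ n<l) y y≈x rewrite ℕ.+-identityʳ n = y≈x n n<l
    agree -[1+ n ] _           y y≈x = refl

theorem12 : ∀ {c ℓ : Level} (q : ℕ) → IsPrimePower q → (𝔽 : FiniteField c ℓ q) →
    let open LaurentSeries 𝔽 in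
    (m : ℕ) (f : LC) →
    ∃! _≋_ (IsExpansion m f)
    × (∀ β → IsExpansion m f β → ∀ n →
    β n K.≈ ((Δ ⊖ [ m ] ⊛ I) ^ᵒ n) ⟦ f ⟧ O.1#
    × ((Δ ⊖ [ m ] ⊛ I) ^ᵒ n) ⟦ f ⟧ O.1#
    K.≈ K.∑ 0 n (λ i → K.∑ i n (λ j →
    (K.- K.1#) K.^ (n ∸ i) K.* (binomial n j K.∙ [ m ] K.^ (n ∸ j))
    K.* ⟦ f ⟧ (O.T O.^ i) K.* ι (𝒟 i (O.T O.^ j)))))
theorem12 q q-primePower 𝔽 m f =
  (β , (β⟶0 , expansion) , λ {γ} γ-expansion n i → F.sym (unique γ (proj₂ γ-expansion) n i)) ,
  λ γ γ-expansion n → unique γ (proj₂ γ-expansion) n , β-formula n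
  where
  open LaurentSeries 𝔽
  open LaurentFiltration 𝔽
  module F = FiniteField 𝔽
  module f = LC f
  open Expansions.Coefficients 𝔽 K-filteredAlgebra q-primePower m ⟦ f ⟧
    (Func.cong f.func) f.additive f.homogeneous (continuous⇒close ⟦ f ⟧ f.continuous)
    (λ n i → ((Δ ⊖ [ m ] ⊛ I) ^ᵒ n) ⟦ f ⟧ (O.T O.^ i))
    (λ i _ → F.refl) (λ n i _ → F.refl)
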